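{- Let $\mathcal A$ be an arrangement of $n$ hyperplanes of rank $r$ in a finite-dimensional complex vector space $V$. Then $$\mathrm{Hilb}(C_{\mathcal A,-1};q)=q^{n-r}\,T_{\mathcal A}\!\left(1,\frac1q\right).$$
   Context: $\mathbb C[V^*]$ denotes the algebra of polynomial functions on $V$. A (central) arrangement $\mathcal A=\{H_1,\dots,H_n\}$ in $V$ is a finite collection (repetitions allowed) of hyperplanes $H_i=\{l_i=0\}$ with $l_i\in V^*$; the degenerate case $l_i=0$ (a loop) is allowed. Its matroid is the linear matroid of $l_1,\dots,l_n$ with rank function $r(\cdot)$; the rank of $\mathcal A$ is $r=\dim\mathrm{span}(l_1,\dots,l_n)$. For nonzero $h\in V$, $\rho_{\mathcal A}(h)$ is the number of hyperplanes of $\mathcal A$ not containing $h$, i.e. the number of $i$ with $l_i(h)\neq 0$. $C_{\mathcal A,-1}$ is the space of $f\in\mathbb C[V^*]$ such that for every nonzero $h\in V$ the $\rho_{\mathcal A}(h)$-th power of the directional derivative along $h$ annihilates $f$ (equivalently, $f$ has degree at most $\rho_{\mathcal A}(h)-1$ on every affine line of direction $h$); it is graded by degree, and $\mathrm{Hilb}(C;q)=\sum_i \dim C_i\,q^i$. The Tutte polynomial is $T_{\mathcal A}(x,y)=\sum_{S\subseteq[n]}(x-1)^{r-r(S)}(y-1)^{|S|-r(S)}$.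
   Formalization: The arrangement is assumed essential (hyperplanes meet only in 0, so r = dim V), as otherwise C is 0 and the formula fails; V is K^d for any field K of characteristic 0 with decidable apartness, which ℂ is by excluded middle. -}

module Defs where

open import Algebra.Apartness.Bundles using (HeytingField; HeytingCommutativeRing)
open import Algebra.Bundles using (RawRing; CommutativeRing)
import Algebra.Definitions.RawMonoid as RawMonoidDefs
import Algebra.Definitions.RawSemiring as RawSemiringDefs
open import Algebra.Module.Bundles.Raw using (RawLeftSemimodule)
import Algebra.Properties.Monoid.Mult as Mult
import Algebra.Properties.Monoid.Sum as Sum
open import Data.Fin.Base using (Fin; zero; suc; toℕ)
open import Data.Fin.Subset using (Subset; inside; outside; ⊤; ∣_∣; _∉_)
open import Data.Integer.Base as ℤ using (ℤ; 0ℤ; 1ℤ)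
open import Data.List.Base using (length; filter; allFin)
open import Data.Nat.Base as ℕ using (ℕ; zero; suc; _∸_; _<_; _⊔_)
import Data.Nat.Properties as ℕₚ
open import Data.Nat.GeneralisedArithmetic using (fold)
open import Data.Product.Base using (∃-syntax; _×_; _,_)
open import Data.Vec.Base as Vec using (Vec; []; _∷_; lookup; updateAt)
open import Data.Vec.Functional using (Vector)
open import Level using (0ℓ) renaming (_⊔_ to _⊔ˡ_)
open import Relation.Binary.Definitions using (Decidable)
open import Relation.Binary.PropositionalEquality.Core using (_≡_; _≢_; refl; sym; cong; subst)
open import Relation.Nullary.Negation.Core using (¬_)

------------------------------------------------------------------------
-- The Tutte polynomial of a rank function, evaluated in a ring

module _ {c ℓ} (R : RawRing c ℓ) where
  open RawRing R
  open RawSemiringDefs rawSemiring using (_^_)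

  ∑-subsets : ∀ {n} → (Subset n → Carrier) → Carrier
  ∑-subsets {zero}  f = f []
  ∑-subsets {suc n} f = ∑-subsets (λ S → f (outside ∷ S)) + ∑-subsets (λ S → f (inside ∷ S))

  -- The truncated subtractions are exact for the rank function of a matroid.
  tutte : ∀ {n} → (Subset n → ℕ) → Carrier → Carrier → Carrier
  tutte r x y = ∑-subsets λ S → (x + - 1#) ^ (r ⊤ ∸ r S) * (y + - 1#) ^ (∣ S ∣ ∸ r S)

------------------------------------------------------------------------
-- Formal Laurent series in q with integer coefficients

infix 5 q⁻^_·_

-- q⁻^ a · f  denotes  q⁻ᵃ (f 0 + f 1 q + f 2 q² + ⋯).  The representation is
-- not unique; _≈ᴸ_ below compares the series represented.
record Laurent : Set where
  constructor q⁻^_·_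
  field
    pole   : ℕ
    series : ℕ → ℤ

-- Multiplication of a power series by qᵐ.
shift : ℕ → (ℕ → ℤ) → (ℕ → ℤ)
shift zero    f k       = f k
shift (suc m) f zero    = 0ℤ
shift (suc m) f (suc k) = shift m f k

cauchyProduct : (ℕ → ℤ) → (ℕ → ℤ) → (ℕ → ℤ)
cauchyProduct f g k = sum {suc k} λ i → f (toℕ i) ℤ.* g (k ∸ toℕ i)
  where open RawMonoidDefs ℤ.+-0-rawMonoid using (sum)

monomial : ℕ → (ℕ → ℤ)
monomial m = shift m λ { zero → 1ℤ ; (suc _) → 0ℤ }

infix 4 _≈ᴸ_

_≈ᴸ_ : Laurent → Laurent → Set
(q⁻^ a · f) ≈ᴸ (q⁻^ b · g) = ∀ k → shift b f k ≡ shift a g k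

laurentRing : RawRing 0ℓ 0ℓ
laurentRing = record
  { Carrier = Laurent
  ; _≈_     = _≈ᴸ_
  ; _+_     = λ { (q⁻^ a · f) (q⁻^ b · g) → q⁻^ a ℕ.+ b · λ k → shift b f k ℤ.+ shift a g k }
  ; _*_     = λ { (q⁻^ a · f) (q⁻^ b · g) → q⁻^ a ℕ.+ b · cauchyProduct f g }
  ; -_      = λ { (q⁻^ a · f) → q⁻^ a · λ k → ℤ.- f k }
  ; 0#      = q⁻^ 0 · λ _ → 0ℤ
  ; 1#      = q⁻^ 0 · monomial 0
  }

q q⁻¹ : Laurent
q   = q⁻^ 0 · monomial 1
q⁻¹ = q⁻^ 1 · monomial 0

generatingFunction : (ℕ → ℕ) → Laurent
generatingFunction a = q⁻^ 0 · λ i → ℤ.+ a i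

------------------------------------------------------------------------
-- Dimension of subspaces

module _ {c ℓ m ℓm} (K : RawRing c ℓ) (M : RawLeftSemimodule (RawRing.Carrier K) m ℓm) where
  open RawRing K using (Carrier; _≈_; 0#)
  open RawLeftSemimodule M
  open RawMonoidDefs +ᴹ-rawMonoid using (sum)

  linearCombination : ∀ {k} → Vector Carrier k → Vector Carrierᴹ k → Carrierᴹ
  linearCombination a v = sum λ i → a i *ₗ v i

  LinearlyIndependent : ∀ {k} → Vector Carrierᴹ k → Set (c ⊔ˡ ℓ ⊔ˡ ℓm)
  LinearlyIndependent v = ∀ a → linearCombination a v ≈ᴹ 0ᴹ → ∀ i → a i ≈ 0#

  -- The span of the members of the family v indexed by S.
  Span : ∀ {k} → Vector Carrierᴹ k → Subset k → Carrierᴹ → Set (c ⊔ˡ ℓ ⊔ˡ ℓm)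
  Span v S w = ∃[ a ] (∀ {i} → i ∉ S → a i ≈ 0#) × w ≈ᴹ linearCombination a v

  HasDimension : ∀ {p} → (Carrierᴹ → Set p) → ℕ → Set (c ⊔ˡ ℓ ⊔ˡ m ⊔ˡ ℓm ⊔ˡ p)
  HasDimension W k = ∃[ b ] (∀ i → W (b i)) × LinearlyIndependent {k} b × (∀ w → W w → Span b ⊤ w)

------------------------------------------------------------------------
-- Arrangements in V = Kᵈ

CharacteristicZero : ∀ {c ℓ₁ ℓ₂} → HeytingField c ℓ₁ ℓ₂ → Set ℓ₁
CharacteristicZero K = ∀ n → ¬ (suc n ×ᴷ 1# ≈ 0#)
  where
  open HeytingField K using (heytingCommutativeRing)
  open CommutativeRing (HeytingCommutativeRing.commutativeRing heytingCommutativeRing)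
  open RawMonoidDefs +-rawMonoid using () renaming (_×_ to _×ᴷ_)

-- A decidable apartness makes a Heyting field a discrete field: every element
-- is zero or invertible.  Classically this holds in every field, with _#_
-- the negation of _≈_.
module Arrangement {c ℓ₁ ℓ₂} (K : HeytingField c ℓ₁ ℓ₂)
                   (_#?_ : Decidable (HeytingField._#_ K)) where

  open HeytingField K using (heytingCommutativeRing)
  open CommutativeRing (HeytingCommutativeRing.commutativeRing heytingCommutativeRing)
    renaming (refl to ≈-refl; trans to ≈-trans; rawRing to rawK) hiding (sym)
  open Mult +-monoid using (×-congʳ) renaming (_×_ to _×ᴷ_)
  open Sum +-monoid using (sum)

  -- Vectors of V = Kᵈ, and linear forms on V in the dual coordinates.
  coordinateSpace : ℕ → RawLeftSemimodule Carrier c ℓ₁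
  coordinateSpace d = record
    { Carrierᴹ = Vector Carrier d
    ; _≈ᴹ_     = λ u v → ∀ j → u j ≈ v j
    ; _+ᴹ_     = λ u v j → u j + v j
    ; _*ₗ_     = λ a v j → a * v j
    ; 0ᴹ       = λ _ → 0#
    }

  -- ⟨ l , h ⟩ is the value l(h) of the linear form l at h.
  ⟨_,_⟩ : ∀ {d} → Vector Carrier d → Vector Carrier d → Carrier
  ⟨ l , h ⟩ = sum λ j → l j * h j

  Nonzero : ∀ {d} → Vector Carrier d → Set ℓ₁
  Nonzero h = ¬ (∀ j → h j ≈ 0#)

  -- The forms l₁, …, lₙ defining the hyperplanes lᵢ = 0; neither repeated nor
  -- zero forms are excluded.
  Forms : ℕ → ℕ → Set c
  Forms d n = Vector (Vector Carrier d) n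

  -- The intersection of all the hyperplanes is zero, i.e. the rank is d.  (A
  -- nonzero h in the intersection has ρ h = 0, which makes C below zero.)
  Essential : ∀ {d n} → Forms d n → Set (c ⊔ˡ ℓ₁)
  Essential {d} l = ∀ (h : Vector Carrier d) → (∀ i → ⟨ l i , h ⟩ ≈ 0#) → ∀ j → h j ≈ 0#

  IsRankFunction : ∀ {d n} → Forms d n → (Subset n → ℕ) → Set (c ⊔ˡ ℓ₁)
  IsRankFunction {d} l r = ∀ S → HasDimension rawK (coordinateSpace d) (Span rawK (coordinateSpace d) l S) (r S)

  ρ : ∀ {d n} → Forms d n → Vector Carrier d → ℕ
  ρ {n = n} l h = length (filter (λ i → ⟨ l i , h ⟩ #? 0#) (allFin n))

  -- Polynomials on V in the coordinates x₁, …, x_d: coeff α is the coefficient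
  -- of x₁^α₁ ⋯ x_d^α_d.  As K is infinite these are the polynomial functions on V.
  record Poly (d : ℕ) : Set (c ⊔ˡ ℓ₁) where
    field
      coeff   : Vec ℕ d → Carrier
      bounded : ∃[ N ] ∀ α → N < Vec.sum α → coeff α ≈ 0#

  open Poly public

  private
    sum-updateAt-suc : ∀ {d} (α : Vec ℕ d) j → Vec.sum (updateAt α j suc) ≡ suc (Vec.sum α)
    sum-updateAt-suc (a ∷ α) zero    = refl
    sum-updateAt-suc (a ∷ α) (suc j) rewrite sum-updateAt-suc α j = ℕₚ.+-suc a (Vec.sum α)

    n×0≈0 : ∀ n → n ×ᴷ 0# ≈ 0#
    n×0≈0 zero    = ≈-refl
    n×0≈0 (suc n) = ≈-trans (+-identityˡ _) (n×0≈0 n)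

  polySpace : ℕ → RawLeftSemimodule Carrier (c ⊔ˡ ℓ₁) ℓ₁
  polySpace d = record
    { Carrierᴹ = Poly d
    ; _≈ᴹ_     = λ f g → ∀ α → coeff f α ≈ coeff g α
    ; _+ᴹ_     = add
    ; _*ₗ_     = scale
    ; 0ᴹ       = record { coeff = λ _ → 0# ; bounded = 0 , λ _ _ → ≈-refl }
    }
    where
    add : Poly d → Poly d → Poly d
    add f g .coeff α = coeff f α + coeff g α
    add f g .bounded with bounded f | bounded g
    ... | N , f≈0 | M , g≈0 = N ⊔ M , λ α lt →
      ≈-trans (+-cong (f≈0 α (ℕₚ.≤-<-trans (ℕₚ.m≤m⊔n N M) lt))
                      (g≈0 α (ℕₚ.≤-<-trans (ℕₚ.m≤n⊔m N M) lt)))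
              (+-identityˡ 0#)

    scale : Carrier → Poly d → Poly d
    scale a f .coeff α = a * coeff f α
    scale a f .bounded with bounded f
    ... | N , f≈0 = N , λ α lt → ≈-trans (*-congˡ (f≈0 α lt)) (zeroʳ a)

  ∂ : ∀ {d} → Fin d → Poly d → Poly d
  ∂ j f .coeff α = suc (lookup α j) ×ᴷ coeff f (updateAt α j suc)
  ∂ j f .bounded with bounded f
  ... | N , f≈0 = N , λ α lt →
    ≈-trans (×-congʳ (suc (lookup α j))
              (f≈0 (updateAt α j suc) (subst (N <_) (sym (sum-updateAt-suc α j)) (ℕₚ.m<n⇒m<1+n lt))))
            (n×0≈0 (suc (lookup α j)))

  directionalDerivative : ∀ {d} → Vector Carrier d → Poly d → Poly d
  directionalDerivative {d} h f = linearCombination rawK (polySpace d) h (λ j → ∂ j f)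

  IsHomogeneous : ∀ {d} → ℕ → Poly d → Set ℓ₁
  IsHomogeneous i f = ∀ α → Vec.sum α ≢ i → coeff f α ≈ 0#

  -- The space C_{𝒜,-1}.
  C : ∀ {d n} → Forms d n → Poly d → Set (c ⊔ˡ ℓ₁)
  C {d} l f = ∀ (h : Vector Carrier d) → Nonzero h →
              ∀ α → coeff (fold f (directionalDerivative h) (ρ l h)) α ≈ 0#

  -- The conditions defining C are homogeneous, so its graded piece of degree i
  -- consists of the homogeneous polynomials of degree i in C.
  gradedC : ∀ {d n} → Forms d n → ℕ → Poly d → Set (c ⊔ˡ ℓ₁)
  gradedC l i f = IsHomogeneous i f × C l f

  IsHilbertFunction : ∀ {d n} → Forms d n → (ℕ → ℕ) → Set (c ⊔ˡ ℓ₁)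
  IsHilbertFunction {d} l a = ∀ i → HasDimension rawK (polySpace d) (gradedC l i) (a i)

module Submission where

{- Fix a nonzero form l among the forms of 𝒜, with hyperplane H.  Multiplication by l and restriction to
   H give an exact sequence

     0 → C(𝒜 \ l)(-1) → C(𝒜) → C(𝒜 / l) → 0

   (C(𝒜 \ l) = 0 when l is a coloop).  Exactness in the middle holds because, in characteristic 0, D_h^(m+1)
   annihilates l g with l(h) ≠ 0 only if D_h^m annihilates g.  For surjectivity one carries along a basis
   of C(𝒜) that consists of products of forms over sets S whose complement spans: such a product over a set
   of C(𝒜 / l) lifts to the product of the same forms in C(𝒜), because the complement now contains l.
   The sum of (y - 1)^(|S| - d) over the spanning sets S satisfies the matching recursion. -}

open import Defs
open import Algebra.Apartness.Bundles using (HeytingField; HeytingCommutativeRing)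
import Algebra.Apartness.Properties.HeytingCommutativeRing as HeytingProperties
open import Algebra.Bundles using (CommutativeRing; RawRing)
open import Algebra.Definitions.RawSemiring (RawRing.rawSemiring laurentRing) using (_^_)
import Algebra.Properties.Ring as RingProperties
import Algebra.Properties.Semiring.Mult as SemiringMult
import Algebra.Properties.Semiring.Sum as SemiringSum
import Algebra.Solver.Ring.NaturalCoefficients.Default as NatSolver
open import Data.Bool.Base using (Bool; true; false)
open import Data.Empty using (⊥-elim)
open import Data.Fin.Base using (Fin; zero; suc; punchIn; punchOut; _↑ˡ_; _↑ʳ_; splitAt)
open import Data.Fin.Properties using (any?; punchInᵢ≢i; punchIn-punchOut; _≟_)
open import Data.Fin.Subset using (Subset; inside; outside; ⊤; ∣_∣; _∈_; _∉_)
open import Data.Fin.Subset.Properties using (∈⊤; _∈?_)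
open import Data.Integer.Base as ℤ using (ℤ; 0ℤ)
import Data.Integer.Properties as ℤₚ
open import Data.Integer.Tactic.RingSolver using (solve-∀)
open import Data.List.Base using (List; []; _∷_; _++_; replicate; length; map; filter; tabulate)
import Data.List.Properties as Listₚ
open import Data.List.Relation.Binary.Permutation.Propositional using (_↭_; prep; swap)
  renaming (refl to ↭refl; trans to ↭trans)
import Data.List.Relation.Binary.Permutation.Propositional.Properties as ↭ₚ
open import Data.Nat.Base as ℕ using (ℕ; zero; suc; _∸_; _≤_; _<_; z≤n; s≤s)
open import Data.Nat.GeneralisedArithmetic using (fold)
import Data.Nat.Properties as ℕₚ
open import Data.Product.Base using (∃-syntax; _×_; _,_; proj₁; proj₂; uncurry)
open import Data.Sum.Base using (_⊎_; inj₁; inj₂)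
open import Data.Vec.Base as Vec using (Vec; []; _∷_; here; there; lookup; updateAt)
import Data.Vec.Properties as Vecₚ
open import Data.Vec.Functional as Vector using (Vector; insertAt; removeAt)
import Data.Vec.Functional.Properties as Vectorₚ
open import Function.Base using (_∘_; const; id)
open import Function.Bundles using (mk⇔)
import Level
open import Relation.Binary.Definitions using (Decidable)
import Relation.Binary.Reasoning.Setoid as SetoidReasoning
open import Relation.Binary.PropositionalEquality using (_≡_; _≢_; _≗_; cong; cong₂; subst; module ≡-Reasoning)
  renaming (refl to ≡refl; sym to ≡sym; trans to ≡trans)
open import Relation.Nullary using (Dec; yes; no; does; ¬_)
open import Relation.Nullary.Decidable using (dec-true; dec-false; does-⇔)

-- Coefficients of monomials suit neither restriction to H nor arbitrary directions h. A polynomial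
-- is therefore replaced by its iterated directional derivatives at 0, a symmetric multilinear
-- function of a word of directions: D_h prepends a letter, restriction to H maps the letters along
-- a parametrization, and multiplication by a form is the Leibniz rule. Division by l, which has no
-- direct description on words, comes from inverting 1 + l D_u for a direction u with l(u) = 1.
--
-- A product over S lies in C(𝒜) because its degree along h is at most the number of its factors
-- that do not vanish at h; a form outside S with nonzero value at h makes this number smaller than
-- ρ(h).
--
-- The recursion is recorded in a tree that no longer mentions the field. The Hilbert function, the
-- basis sets and the spanning sets are read off the tree, and the two sides of the identity are
-- compared there. Coloops need no separate case: deleting one leaves forms that do not span, and
-- every leaf of the tree of the deletion is then `flat`, contributing nothing.

private variable
  d e m n : ℕ

-- The shape of a deletion-contraction tree of n forms on Kᵈ, the first form being treated first: loop for
-- a zero form; otherwise pivot, with the trees of the deletion and of the contraction.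
data DCTree : ℕ → ℕ → Set where
  point : DCTree 0 0
  flat  : DCTree (suc d) 0
  loop  : DCTree d n → DCTree d (suc n)
  pivot : DCTree (suc d) n → DCTree d n → DCTree (suc d) (suc n)

suspend : (ℕ → ℕ) → ℕ → ℕ
suspend a zero    = 0
suspend a (suc i) = a i

-- At a `point` leaf V = 0, and C consists of the constants. At a `flat` leaf every direction has ρ
-- = 0, so the condition on f reads f = 0.
hilb : DCTree d n → ℕ → ℕ
hilb point zero    = 1
hilb point (suc _) = 0
hilb flat  _       = 0
hilb (loop t)     i = hilb t i
hilb (pivot t t′) i = suspend (hilb t) i ℕ.+ hilb t′ i

-- At a pivot, membership in `S` selects contraction or deletion; the leaf reached is `point`
-- exactly when the forms in `S` have only 0 as a common zero.
spans : DCTree d n → Subset n → Bool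
spans point        []            = true
spans flat         []            = false
spans (loop t)     (_ ∷ S)       = spans t S
spans (pivot t t′) (outside ∷ S) = spans t S
spans (pivot t t′) (inside ∷ S)  = spans t′ S

spans⇒≤ : ∀ (t : DCTree d n) S → spans t S ≡ true → d ≤ ∣ S ∣
spans⇒≤ point        []            _ = z≤n
spans⇒≤ (loop t)     (outside ∷ S) s = spans⇒≤ t S s
spans⇒≤ (loop t)     (inside ∷ S)  s = ℕₚ.m≤n⇒m≤1+n (spans⇒≤ t S s)
spans⇒≤ (pivot t t′) (outside ∷ S) s = spans⇒≤ t S s
spans⇒≤ (pivot t t′) (inside ∷ S)  s = s≤s (spans⇒≤ t′ S s)

-- At x = 1 the factor (x - 1)^(r - r(S)) is 1 for a spanning set and 0 for any other, so the rank
-- of a set that does not span enters only through the inequality.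
HasRank : ℕ → Bool → ℕ → Set
HasRank d true  s = s ≡ d
HasRank d false s = s < d

-- The Tutte evaluation as a power series

module LaurentSeries where

  open import Data.Nat.Base using (_+_)
  open RawRing laurentRing using (_≈_; _*_; 1#) renaming (_+_ to _⊕_; -_ to ⊝_)

  -- Power series

  infixl 6 _+ˢ_

  _+ˢ_ : (ℕ → ℤ) → (ℕ → ℤ) → ℕ → ℤ
  (f +ˢ g) k = f k ℤ.+ g k

  shift-cong : ∀ m {f g} → f ≗ g → shift m f ≗ shift m g
  shift-cong zero    f≗g k       = f≗g k
  shift-cong (suc m) f≗g zero    = ≡refl
  shift-cong (suc m) f≗g (suc k) = shift-cong m f≗g k

  shift-+ : ∀ m n f → shift (m + n) f ≗ shift m (shift n f)
  shift-+ zero    n f k       = ≡refl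
  shift-+ (suc m) n f zero    = ≡refl
  shift-+ (suc m) n f (suc k) = shift-+ m n f k

  shift-comm : ∀ m n f → shift m (shift n f) ≗ shift n (shift m f)
  shift-comm m n f k = begin
    shift m (shift n f) k ≡⟨ shift-+ m n f k ⟨
    shift (m + n) f k     ≡⟨ cong (λ s → shift s f k) (ℕₚ.+-comm m n) ⟩
    shift (n + m) f k     ≡⟨ shift-+ n m f k ⟩
    shift n (shift m f) k ∎
    where open ≡-Reasoning

  shift-+ˢ : ∀ m f g → shift m (f +ˢ g) ≗ shift m f +ˢ shift m g
  shift-+ˢ zero    f g k       = ≡refl
  shift-+ˢ (suc m) f g zero    = ≡refl
  shift-+ˢ (suc m) f g (suc k) = shift-+ˢ m f g k

  shift-zero : ∀ m → shift m (const 0ℤ) ≗ const 0ℤ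
  shift-zero zero    k       = ≡refl
  shift-zero (suc m) zero    = ≡refl
  shift-zero (suc m) (suc k) = shift-zero m k

  shift-shift : ∀ m f k → shift m f (m + k) ≡ f k
  shift-shift zero    f k = ≡refl
  shift-shift (suc m) f k = shift-shift m f k

  shift-injective : ∀ m {f g} → shift m f ≗ shift m g → f ≗ g
  shift-injective m {f} {g} eq k =
    ≡trans (≡sym (shift-shift m f k)) (≡trans (eq (m + k)) (shift-shift m g k))

  -- By unfolding `sum`, the product at `suc k` is definitionally `f 0 ℤ.* g (suc k)` plus the
  -- product of `f ∘ suc` and `g` at `k`. The lemmas on products recurse along this equation.
  cauchyProduct-cong : ∀ {f f′ g g′} → f ≗ f′ → g ≗ g′ → cauchyProduct f g ≗ cauchyProduct f′ g′
  cauchyProduct-cong f≗ g≗ zero    = cong₂ (λ a b → a ℤ.* b ℤ.+ 0ℤ) (f≗ 0) (g≗ 0)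
  cauchyProduct-cong f≗ g≗ (suc k) =
    cong₂ ℤ._+_ (cong₂ ℤ._*_ (f≗ 0) (g≗ (suc k))) (cauchyProduct-cong (f≗ ∘ suc) g≗ k)

  cauchyProduct-const : ∀ f g → (∀ k → f (suc k) ≡ 0ℤ) → ∀ k → cauchyProduct f g k ≡ f 0 ℤ.* g k
  cauchyProduct-const f g f≡0 zero    = ℤₚ.+-identityʳ _
  cauchyProduct-const f g f≡0 (suc k) = begin
    f 0 ℤ.* g (suc k) ℤ.+ cauchyProduct (f ∘ suc) g k
      ≡⟨ cong (ℤ._+_ (f 0 ℤ.* g (suc k))) (cauchyProduct-const (f ∘ suc) g (f≡0 ∘ suc) k) ⟩
    f 0 ℤ.* g (suc k) ℤ.+ f 1 ℤ.* g k
      ≡⟨ cong (λ c → f 0 ℤ.* g (suc k) ℤ.+ c ℤ.* g k) (f≡0 0) ⟩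
    f 0 ℤ.* g (suc k) ℤ.+ 0ℤ
      ≡⟨ ℤₚ.+-identityʳ _ ⟩
    f 0 ℤ.* g (suc k) ∎
    where open ≡-Reasoning

  cauchyProduct-shiftˡ : ∀ m f g → cauchyProduct (shift m f) g ≗ shift m (cauchyProduct f g)
  cauchyProduct-shiftˡ zero    f g k       = ≡refl
  cauchyProduct-shiftˡ (suc m) f g zero    = ≡refl
  cauchyProduct-shiftˡ (suc m) f g (suc k) =
    ≡trans (ℤₚ.+-identityˡ _) (cauchyProduct-shiftˡ m f g k)

  cauchyProduct-shift₁ : ∀ f g → cauchyProduct f (shift 1 g) ≗ shift 1 (cauchyProduct f g)
  cauchyProduct-shift₁ f g zero          = ≡trans (ℤₚ.+-identityʳ _) (ℤₚ.*-zeroʳ (f 0))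
  cauchyProduct-shift₁ f g (suc zero)    =
    cong (ℤ._+_ (f 0 ℤ.* g 0)) (cauchyProduct-shift₁ (f ∘ suc) g 0)
  cauchyProduct-shift₁ f g (suc (suc k)) =
    cong (ℤ._+_ (f 0 ℤ.* g (suc k))) (cauchyProduct-shift₁ (f ∘ suc) g (suc k))

  cauchyProduct-shiftʳ : ∀ m f g → cauchyProduct f (shift m g) ≗ shift m (cauchyProduct f g)
  cauchyProduct-shiftʳ zero    f g k = ≡refl
  cauchyProduct-shiftʳ (suc m) f g k = begin
    cauchyProduct f (shift (suc m) g) k         ≡⟨ cauchyProduct-cong {f} (λ _ → ≡refl) (shift-+ 1 m g) k ⟩
    cauchyProduct f (shift 1 (shift m g)) k     ≡⟨ cauchyProduct-shift₁ f (shift m g) k ⟩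
    shift 1 (cauchyProduct f (shift m g)) k     ≡⟨ shift-cong 1 (cauchyProduct-shiftʳ m f g) k ⟩
    shift 1 (shift m (cauchyProduct f g)) k     ≡⟨ shift-+ 1 m (cauchyProduct f g) k ⟨
    shift (suc m) (cauchyProduct f g) k         ∎
    where open ≡-Reasoning

  -- Multiplication by 1 − q.
  Δ : (ℕ → ℤ) → ℕ → ℤ
  Δ f k = f k ℤ.+ ℤ.- shift 1 f k

  Δ-cong : ∀ {f g} → f ≗ g → Δ f ≗ Δ g
  Δ-cong f≗g k = cong₂ (λ a b → a ℤ.+ ℤ.- b) (f≗g k) (shift-cong 1 f≗g k)

  Δ-+ˢ : ∀ f g → Δ (f +ˢ g) ≗ Δ f +ˢ Δ g
  Δ-+ˢ f g k = ≡trans (cong (λ a → f k ℤ.+ g k ℤ.+ ℤ.- a) (shift-+ˢ 1 f g k))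
                     (interchange (f k) (g k) (shift 1 f k) (shift 1 g k))
    where
    interchange : ∀ a b c e → a ℤ.+ b ℤ.+ ℤ.- (c ℤ.+ e) ≡ (a ℤ.+ ℤ.- c) ℤ.+ (b ℤ.+ ℤ.- e)
    interchange = solve-∀

  shift-neg : ∀ m f → shift m (λ k → ℤ.- f k) ≗ λ k → ℤ.- shift m f k
  shift-neg zero    f k       = ≡refl
  shift-neg (suc m) f zero    = ≡refl
  shift-neg (suc m) f (suc k) = shift-neg m f k

  shift-Δ : ∀ m f → shift m (Δ f) ≗ Δ (shift m f)
  shift-Δ m f k = ≡trans (shift-+ˢ m f (λ j → ℤ.- shift 1 f j) k)
    (cong (ℤ._+_ (shift m f k)) (≡trans (shift-neg m (shift 1 f) k) (cong ℤ.-_ (shift-comm m 1 f k))))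

  Δ^ : ℕ → (ℕ → ℤ) → ℕ → ℤ
  Δ^ k f = fold f Δ k

  Δ^-cong : ∀ k {f g} → f ≗ g → Δ^ k f ≗ Δ^ k g
  Δ^-cong zero    f≗g = f≗g
  Δ^-cong (suc k) f≗g = Δ-cong (Δ^-cong k f≗g)

  Δ^-+ˢ : ∀ k f g → Δ^ k (f +ˢ g) ≗ Δ^ k f +ˢ Δ^ k g
  Δ^-+ˢ zero    f g j = ≡refl
  Δ^-+ˢ (suc k) f g j = ≡trans (Δ-cong (Δ^-+ˢ k f g) j) (Δ-+ˢ (Δ^ k f) (Δ^ k g) j)

  shift-Δ^ : ∀ m k f → shift m (Δ^ k f) ≗ Δ^ k (shift m f)
  shift-Δ^ m zero    f j = ≡refl
  shift-Δ^ m (suc k) f j = ≡trans (shift-Δ m (Δ^ k f) j) (Δ-cong (shift-Δ^ m k f) j)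

  Δ^-zero : ∀ k → Δ^ k (const 0ℤ) ≗ const 0ℤ
  Δ^-zero zero    j       = ≡refl
  Δ^-zero (suc k) zero    = ≡trans (Δ-cong (Δ^-zero k) 0) ≡refl
  Δ^-zero (suc k) (suc j) = Δ-cong (Δ^-zero k) (suc j)

  -- q^ N · P ≈ f says that the Laurent series qᴺ P is the power series f.
  infix 4 q^_·_≈_

  q^_·_≈_ : ℕ → Laurent → (ℕ → ℤ) → Set
  q^ N · P ≈ f = shift (Laurent.pole P) f ≗ shift N (Laurent.series P)

  q^-resp : ∀ {N P f g} → f ≗ g → q^ N · P ≈ f → q^ N · P ≈ g
  q^-resp {P = P} f≗g Pf k = ≡trans (≡sym (shift-cong (Laurent.pole P) f≗g k)) (Pf k)

  q^-weaken : ∀ M {N P f} → q^ N · P ≈ f → q^ M + N · P ≈ shift M f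
  q^-weaken M {N} {q⁻^ a · p} {f} Pf k = begin
    shift a (shift M f) k ≡⟨ shift-comm a M f k ⟩
    shift M (shift a f) k ≡⟨ shift-cong M Pf k ⟩
    shift M (shift N p) k ≡⟨ shift-+ M N p k ⟨
    shift (M + N) p k     ∎
    where open ≡-Reasoning

  q^-cancel : ∀ M {N P f} → q^ M + N · P ≈ shift M f → q^ N · P ≈ f
  q^-cancel M {N} {q⁻^ a · p} {f} Pf = shift-injective M λ k → begin
    shift M (shift a f) k ≡⟨ shift-comm M a f k ⟩
    shift a (shift M f) k ≡⟨ Pf k ⟩
    shift (M + N) p k     ≡⟨ shift-+ M N p k ⟩
    shift M (shift N p) k ∎
    where open ≡-Reasoning

  q^-⊕ : ∀ {N P Q f g} → q^ N · P ≈ f → q^ N · Q ≈ g → q^ N · P ⊕ Q ≈ (f +ˢ g)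
  q^-⊕ {N} {q⁻^ a · p} {q⁻^ b · p′} {f} {g} Pf Qg k = begin
    shift (a + b) (f +ˢ g) k                            ≡⟨ shift-+ˢ (a + b) f g k ⟩
    shift (a + b) f k ℤ.+ shift (a + b) g k             ≡⟨ cong₂ ℤ._+_ lhs rhs ⟩
    shift N (shift b p) k ℤ.+ shift N (shift a p′) k    ≡⟨ shift-+ˢ N (shift b p) (shift a p′) k ⟨
    shift N (shift b p +ˢ shift a p′) k                 ∎
    where
    open ≡-Reasoning
    lhs : shift (a + b) f k ≡ shift N (shift b p) k
    lhs = begin
      shift (a + b) f k     ≡⟨ shift-+ a b f k ⟩
      shift a (shift b f) k ≡⟨ shift-comm a b f k ⟩
      shift b (shift a f) k ≡⟨ shift-cong b Pf k ⟩
      shift b (shift N p) k ≡⟨ shift-comm b N p k ⟩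
      shift N (shift b p) k ∎
    rhs : shift (a + b) g k ≡ shift N (shift a p′) k
    rhs = begin
      shift (a + b) g k      ≡⟨ shift-+ a b g k ⟩
      shift a (shift b g) k  ≡⟨ shift-cong a Qg k ⟩
      shift a (shift N p′) k ≡⟨ shift-comm a N p′ k ⟩
      shift N (shift a p′) k ∎

  q^-* : ∀ {M N P Q f g} → q^ M · P ≈ f → q^ N · Q ≈ g → q^ M + N · P * Q ≈ cauchyProduct f g
  q^-* {M} {N} {q⁻^ a · p} {q⁻^ b · p′} {f} {g} Pf Qg k = begin
    shift (a + b) (cauchyProduct f g) k           ≡⟨ shifts a b f g ⟩
    cauchyProduct (shift a f) (shift b g) k       ≡⟨ cauchyProduct-cong Pf Qg k ⟩
    cauchyProduct (shift M p) (shift N p′) k      ≡⟨ shifts M N p p′ ⟨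
    shift (M + N) (cauchyProduct p p′) k          ∎
    where
    open ≡-Reasoning
    shifts : ∀ a b f g → shift (a + b) (cauchyProduct f g) k ≡ cauchyProduct (shift a f) (shift b g) k
    shifts a b f g = begin
      shift (a + b) (cauchyProduct f g) k         ≡⟨ shift-+ a b _ k ⟩
      shift a (shift b (cauchyProduct f g)) k     ≡⟨ shift-cong a (cauchyProduct-shiftʳ b f g) k ⟨
      shift a (cauchyProduct f (shift b g)) k     ≡⟨ cauchyProduct-shiftˡ a f (shift b g) k ⟨
      cauchyProduct (shift a f) (shift b g) k     ∎

  q^-1# : q^ 0 · 1# ≈ monomial 0
  q^-1# k = ≡refl

  q⁻¹-1 1-1 : Laurent
  q⁻¹-1 = q⁻¹ ⊕ ⊝ 1#
  1-1   = 1# ⊕ ⊝ 1#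

  q^-q⁻¹-1 : ∀ {N P f} → q^ N · P ≈ f → q^ suc N · q⁻¹-1 * P ≈ Δ f
  q^-q⁻¹-1 {N} {P} {f} Pf = q^-resp {suc N} {q⁻¹-1 * P} times
    (q^-* {1} {N} {q⁻¹-1} {P} {s} {f} (λ _ → ≡refl) Pf)
    where
    -- The pole of `q⁻¹-1` is 1 and its series is 1 - q, with coefficients 1, -1, 0, 0, and so on.
    s = Laurent.series q⁻¹-1
    times : cauchyProduct s f ≗ Δ f
    times zero    = ≡trans (ℤₚ.+-identityʳ _) (≡trans (ℤₚ.*-identityˡ (f 0)) (≡sym (ℤₚ.+-identityʳ _)))
    times (suc k) = cong₂ ℤ._+_ (ℤₚ.*-identityˡ (f (suc k)))
      (≡trans (cauchyProduct-const (s ∘ suc) f (λ _ → ≡refl) k) (ℤₚ.-1*i≡-i (f k)))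

  q^-q⁻¹-1^ : ∀ m → q^ m · q⁻¹-1 ^ m ≈ Δ^ m (monomial 0)
  q^-q⁻¹-1^ zero    = q^-1#
  q^-q⁻¹-1^ (suc m) = q^-q⁻¹-1 {m} {q⁻¹-1 ^ m} (q^-q⁻¹-1^ m)

  q^-zero* : ∀ P Q → q^ 0 · P ≈ const 0ℤ → q^ 0 · P * Q ≈ const 0ℤ
  q^-zero* (q⁻^ a · p) (q⁻^ b · p′) P≈0 k = ≡trans (shift-zero (a + b) k) (≡sym (begin
    cauchyProduct p p′ k ≡⟨ cauchyProduct-const p p′ (λ j → p≡0 (suc j)) k ⟩
    p 0 ℤ.* p′ k         ≡⟨ cong (ℤ._* p′ k) (p≡0 0) ⟩
    0ℤ                   ∎))
    where
    open ≡-Reasoning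
    p≡0 : p ≗ const 0ℤ
    p≡0 j = ≡trans (≡sym (P≈0 j)) (shift-zero a j)

  q^-1-1 : q^ 0 · 1-1 ≈ const 0ℤ
  q^-1-1 zero    = ≡refl
  q^-1-1 (suc k) = ≡refl

  cauchyProduct-monomial : ∀ m f → cauchyProduct (monomial m) f ≗ shift m f
  cauchyProduct-monomial zero f k =
    ≡trans (cauchyProduct-const (monomial 0) f (λ _ → ≡refl) k) (ℤₚ.*-identityˡ (f k))
  cauchyProduct-monomial (suc m) f zero    = ≡refl
  cauchyProduct-monomial (suc m) f (suc k) = ≡trans (ℤₚ.+-identityˡ _) (cauchyProduct-monomial m f k)

  q^-q^ : ∀ m → q^ 0 · q ^ m ≈ monomial m
  q^-q^ zero    = q^-1#
  q^-q^ (suc m) = q^-resp {0} {q ^ suc m} (λ k →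
      ≡trans (cauchyProduct-monomial 1 (monomial m) k) (≡sym (shift-+ 1 m _ k)))
    (q^-* {0} {0} {q} {q ^ m} {monomial 1} (λ _ → ≡refl) (q^-q^ m))

  q^-1#* : ∀ {N P f} → q^ N · P ≈ f → q^ N · 1# * P ≈ f
  q^-1#* {N} {P} {f} Pf = q^-resp {N} {1# * P} (cauchyProduct-monomial 0 f) (q^-* {0} {N} {1#} {P} q^-1# Pf)

  q^-q^* : ∀ m {N P f} → q^ N · P ≈ f → q^ N · q ^ m * P ≈ shift m f
  q^-q^* m {N} {P} {f} Pf = q^-resp {N} {q ^ m * P} (cauchyProduct-monomial m f)
    (q^-* {0} {N} {q ^ m} {P} (q^-q^ m) Pf)

  -- `Δ^ m (monomial 0)` is (1 - q)^m = q^m (1/q - 1)^m, so the first case says that `P` represents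
  -- (1/q - 1)^m. The second is the vanishing summand of a set that does not span.
  IsTerm : Bool → ℕ → Laurent → Set
  IsTerm true  m P = q^ m · P ≈ Δ^ m (monomial 0)
  IsTerm false m P = q^ 0 · P ≈ const 0ℤ

  hilbSeries : DCTree d n → ℕ → ℤ
  hilbSeries t i = ℤ.+ hilb t i

  -- The exponent k accumulates a factor (q⁻¹ - 1)ᵏ coming from the loops in S.
  ∑-subsets-spanning : ∀ (t : DCTree d n) k (u : Subset n → Laurent) →
    (∀ S → IsTerm (spans t S) (∣ S ∣ ∸ d + k) (u S)) →
    q^ n + k · ∑-subsets laurentRing u ≈ Δ^ k (shift d (hilbSeries t))
  ∑-subsets-spanning point k u term =
    q^-resp {k} {u []} (Δ^-cong k λ { zero → ≡refl ; (suc _) → ≡refl }) (term [])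
  ∑-subsets-spanning (flat {d}) k u term = q^-resp {k} {u []} zeros
    (subst (λ m → q^ m · u [] ≈ shift k (const 0ℤ)) (ℕₚ.+-identityʳ k) (q^-weaken k {0} {u []} (term [])))
    where
    zeros : shift k (const 0ℤ) ≗ Δ^ k (shift (suc d) (const 0ℤ))
    zeros j = ≡trans (shift-zero k j) (≡sym (≡trans (Δ^-cong k (shift-zero (suc d)) j) (Δ^-zero k j)))
  ∑-subsets-spanning {d} {suc n} (loop t) k u term =
    q^-resp {suc n + k} {P ⊕ Q} telescope (q^-⊕ {suc n + k} {P} {Q} Pf Qg)
    where
    h = shift d (hilbSeries t)
    P = ∑-subsets laurentRing (λ S → u (outside ∷ S))
    Q = ∑-subsets laurentRing (λ S → u (inside ∷ S))
    Pf : q^ suc n + k · P ≈ shift 1 (Δ^ k h)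
    Pf = q^-weaken 1 {n + k} {P} (∑-subsets-spanning t k (λ S → u (outside ∷ S)) (λ S → term (outside ∷ S)))
    -- For a spanning `S` the truncated difference `∣ S ∣ ∸ d` is exact, so the loop raises it by
    -- one, and this one is moved into `k`. For the other sets `IsTerm` ignores the exponent.
    exponent : ∀ S b → spans t S ≡ b → IsTerm b (suc ∣ S ∣ ∸ d + k) (u (inside ∷ S)) →
               IsTerm b (∣ S ∣ ∸ d + suc k) (u (inside ∷ S))
    exponent S false _ x = x
    exponent S true  s x = subst (λ m → IsTerm true m (u (inside ∷ S)))
      (≡trans (cong (_+ k) (ℕₚ.+-∸-assoc 1 (spans⇒≤ t S s))) (≡sym (ℕₚ.+-suc (∣ S ∣ ∸ d) k))) x
    Qg : q^ suc n + k · Q ≈ Δ^ (suc k) h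
    Qg = subst (λ m → q^ m · Q ≈ Δ^ (suc k) h) (ℕₚ.+-suc n k)
      (∑-subsets-spanning t (suc k) (λ S → u (inside ∷ S)) (λ S → exponent S _ ≡refl (term (inside ∷ S))))
    -- A loop contributes the factor q from the sets without it and q (1/q - 1) = 1 - q from the
    -- sets with it; these add up to 1.
    telescope : shift 1 (Δ^ k h) +ˢ Δ^ (suc k) h ≗ Δ^ k h
    telescope j = cancel (shift 1 (Δ^ k h) j) (Δ^ k h j)
      where
      cancel : ∀ a b → a ℤ.+ (b ℤ.+ ℤ.- a) ≡ b
      cancel = solve-∀
  ∑-subsets-spanning {suc d} {suc n} (pivot t t′) k u term =
    q^-resp {suc n + k} {P ⊕ Q} combine (q^-⊕ {suc n + k} {P} {Q} Pf Qg)
    where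
    h  = hilbSeries t
    h′ = hilbSeries t′
    P = ∑-subsets laurentRing (λ S → u (outside ∷ S))
    Q = ∑-subsets laurentRing (λ S → u (inside ∷ S))
    Pf : q^ suc n + k · P ≈ shift 1 (Δ^ k (shift (suc d) h))
    Pf = q^-weaken 1 {n + k} {P} (∑-subsets-spanning t k (λ S → u (outside ∷ S)) (λ S → term (outside ∷ S)))
    Qg : q^ suc n + k · Q ≈ shift 1 (Δ^ k (shift d h′))
    Qg = q^-weaken 1 {n + k} {Q} (∑-subsets-spanning t′ k (λ S → u (inside ∷ S)) (λ S → term (inside ∷ S)))
    open ≡-Reasoning
    recursion : shift 1 h +ˢ h′ ≗ hilbSeries (pivot t t′)
    recursion zero    = ℤₚ.+-identityˡ _
    recursion (suc i) = ≡refl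
    -- The factor q of the additional form becomes the degree shift `suspend` in the deletion; in
    -- the contraction it turns q^d into q^(d+1).
    combine : shift 1 (Δ^ k (shift (suc d) h)) +ˢ shift 1 (Δ^ k (shift d h′))
              ≗ Δ^ k (shift (suc d) (hilbSeries (pivot t t′)))
    combine j = begin
      shift 1 (Δ^ k (shift (suc d) h)) j ℤ.+ shift 1 (Δ^ k (shift d h′)) j
        ≡⟨ cong₂ ℤ._+_ (shift-Δ^ 1 k _ j) (shift-Δ^ 1 k _ j) ⟩
      Δ^ k (shift 1 (shift (suc d) h)) j ℤ.+ Δ^ k (shift 1 (shift d h′)) j
        ≡⟨ cong₂ ℤ._+_ (Δ^-cong k (shift-comm 1 (suc d) h) j) (Δ^-cong k (λ i → ≡sym (shift-+ 1 d h′ i)) j) ⟩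
      Δ^ k (shift (suc d) (shift 1 h)) j ℤ.+ Δ^ k (shift (suc d) h′) j
        ≡⟨ Δ^-+ˢ k _ _ j ⟨
      Δ^ k (shift (suc d) (shift 1 h) +ˢ shift (suc d) h′) j
        ≡⟨ Δ^-cong k (λ i → ≡sym (shift-+ˢ (suc d) (shift 1 h) h′ i)) j ⟩
      Δ^ k (shift (suc d) (shift 1 h +ˢ h′)) j
        ≡⟨ Δ^-cong k (shift-cong (suc d) recursion) j ⟩
      Δ^ k (shift (suc d) (hilbSeries (pivot t t′))) j ∎

  -- The sum over subsets gives q^n T = q^d Hilb. Multiplying by q^(n-d), which is exact as d ≤ n,
  -- makes the right side q^n Hilb, and q^n cancels.
  tutte-hilb : ∀ (t : DCTree d n) (r : Subset n → ℕ) → d ≤ n → r ⊤ ≡ d →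
               (∀ S → HasRank d (spans t S) (r S)) →
               generatingFunction (hilb t) ≈ q ^ (n ∸ r ⊤) * tutte laurentRing r 1# q⁻¹
  tutte-hilb {d} {n} t r d≤n ≡refl rank k = q^-cancel n {0} {product}
    (subst (λ m → q^ m · product ≈ shift n h) (≡sym (ℕₚ.+-identityʳ n))
    (q^-resp {n} {product} shifts (q^-q^* (n ∸ d) {n} {T} T-hilb))) k
    where
    h = hilbSeries t
    T = tutte laurentRing r 1# q⁻¹
    product = q ^ (n ∸ d) * T
    u : ∀ e m → Laurent
    u e m = 1-1 ^ e * q⁻¹-1 ^ m
    term : ∀ b s c → HasRank d b s → IsTerm b (c ∸ d + 0) (u (d ∸ s) (c ∸ s))
    term true s c ≡refl rewrite ℕₚ.n∸n≡0 s | ℕₚ.+-identityʳ (c ∸ s) =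
      q^-1#* {c ∸ s} {q⁻¹-1 ^ (c ∸ s)} (q^-q⁻¹-1^ (c ∸ s))
    -- As s < d, the power of `1-1` has a positive exponent and so contains a zero factor.
    term false s c s<d with d ∸ s | ℕₚ.m<n⇒0<n∸m s<d
    ... | suc e | _ = q^-zero* (1-1 ^ suc e) (q⁻¹-1 ^ (c ∸ s)) (q^-zero* 1-1 (1-1 ^ e) q^-1-1)
    T-hilb : q^ n · T ≈ shift d h
    T-hilb = subst (λ m → q^ m · T ≈ shift d h) (ℕₚ.+-identityʳ n)
      (∑-subsets-spanning t 0 (λ S → u (d ∸ r S) (∣ S ∣ ∸ r S)) (λ S → term (spans t S) (r S) ∣ S ∣ (rank S)))
    shifts : shift (n ∸ d) (shift d h) ≗ shift n h
    shifts j = ≡trans (≡sym (shift-+ (n ∸ d) d h j)) (cong (λ m → shift m h j) (ℕₚ.m∸n+n≡m d≤n))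

module Arrangements {c ℓ₁ ℓ₂} (K : HeytingField c ℓ₁ ℓ₂) (_#?_ : Decidable (HeytingField._#_ K))
                    (char0 : CharacteristicZero K) where

  open Arrangement K _#?_
  open HeytingField K using (heytingCommutativeRing; tight)
  open HeytingCommutativeRing heytingCommutativeRing using (_#_; #⇒invertible; #-irrefl; commutativeRing)
  open CommutativeRing commutativeRing hiding (_-_) renaming (rawRing to rawK; zero to *-zero)
  open HeytingProperties heytingCommutativeRing using (x-0≈x; #-congʳ; x#0y#0→xy#0; 1#0)
  open RingProperties ring using (-1*x≈-x; -‿distribˡ-*; +-cancelˡ)
  open SemiringMult semiring using (×-congʳ; ×-assoc-*) renaming (_×_ to _×ᴷ_)
  open SemiringSum semiring using (sum; sum-cong-≋; sum-remove; ∑-distrib-+; ∑-comm; *-distribˡ-sum; sum-replicate-zero)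
  open NatSolver commutativeSemiring using (solve; _:+_; _:*_; _:=_)
  open SetoidReasoning setoid

  -- Arithmetic in a discrete field of characteristic zero

  ≈0⊎#0 : ∀ x → x ≈ 0# ⊎ x # 0#
  ≈0⊎#0 x with x #? 0#
  ... | yes x#0 = inj₂ x#0
  ... | no ¬x#0 = inj₁ (proj₁ (tight x 0#) ¬x#0)

  ≉0⇒#0 : ∀ {x} → ¬ x ≈ 0# → x # 0#
  ≉0⇒#0 {x} x≉0 with ≈0⊎#0 x
  ... | inj₁ x≈0 = ⊥-elim (x≉0 x≈0)
  ... | inj₂ x#0 = x#0

  reciprocal : ∀ {x} → x # 0# → ∃[ y ] y * x ≈ 1#
  reciprocal {x} x#0 with #⇒invertible x#0
  ... | y , yx≈1 , _ = y , trans (*-congˡ (sym (x-0≈x x))) yx≈1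

  *-cancelˡ-0 : ∀ {x y} → x # 0# → x * y ≈ 0# → y ≈ 0#
  *-cancelˡ-0 {x} {y} x#0 xy≈0 with reciprocal x#0
  ... | x⁻¹ , x⁻¹x≈1 = begin
    y             ≈⟨ *-identityˡ y ⟨
    1# * y        ≈⟨ *-congʳ x⁻¹x≈1 ⟨
    x⁻¹ * x * y   ≈⟨ *-assoc x⁻¹ x y ⟩
    x⁻¹ * (x * y) ≈⟨ *-congˡ xy≈0 ⟩
    x⁻¹ * 0#      ≈⟨ zeroʳ x⁻¹ ⟩
    0#            ∎

  suc×1#0 : ∀ n → suc n ×ᴷ 1# # 0#
  suc×1#0 n = ≉0⇒#0 (char0 n)

  ×ᴷ≈* : ∀ n x → n ×ᴷ x ≈ (n ×ᴷ 1#) * x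
  ×ᴷ≈* n x = sym (trans (×-assoc-* n 1# x) (×-congʳ n (*-identityˡ x)))

  suc×#0 : ∀ n {x} → x # 0# → suc n ×ᴷ x # 0#
  suc×#0 n {x} x#0 = #-congʳ (sym (×ᴷ≈* (suc n) x)) (x#0y#0→xy#0 (suc×1#0 n) x#0)

  +-zero : ∀ {x y} → x ≈ 0# → y ≈ 0# → x + y ≈ 0#
  +-zero x≈0 y≈0 = trans (+-cong x≈0 y≈0) (+-identityˡ 0#)

  *-zeroʳ′ : ∀ x {y} → y ≈ 0# → x * y ≈ 0#
  *-zeroʳ′ x y≈0 = trans (*-congˡ y≈0) (zeroʳ x)

  *-zeroˡ′ : ∀ {x} y → x ≈ 0# → x * y ≈ 0#
  *-zeroˡ′ y x≈0 = trans (*-congʳ x≈0) (zeroˡ y)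

  sum-zero : ∀ {n} {f : Vector Carrier n} → (∀ i → f i ≈ 0#) → sum f ≈ 0#
  sum-zero {n} f≈0 = trans (sum-cong-≋ f≈0) (sum-replicate-zero n)

  sum-++ : ∀ m {k} (f : Vector Carrier (m ℕ.+ k)) → sum f ≈ sum (f ∘ (_↑ˡ k)) + sum (f ∘ (m ↑ʳ_))
  sum-++ zero    f = sym (+-identityˡ (sum f))
  sum-++ (suc m) f = trans (+-congˡ (sum-++ m (f ∘ suc))) (sym (+-assoc _ _ _))

  sum-single : ∀ (f : Vector Carrier n) j → (∀ i → i ≢ j → f i ≈ 0#) → sum f ≈ f j
  sum-single {suc n} f j f≈0 = begin
    sum f                    ≈⟨ sum-remove f ⟩
    f j + sum (removeAt f j) ≈⟨ +-congˡ (sum-zero λ i → f≈0 _ (punchInᵢ≢i j i)) ⟩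
    f j + 0#                 ≈⟨ +-identityʳ (f j) ⟩
    f j                      ∎

  -- Vectors and linear forms

  infix 4 _≈ⱽ_
  _≈ⱽ_ : Vector Carrier n → Vector Carrier n → Set ℓ₁
  u ≈ⱽ v = ∀ j → u j ≈ v j

  0ⱽ : Vector Carrier n
  0ⱽ _ = 0#

  nonzero-coordinate : ∀ {h : Vector Carrier d} → Nonzero h → ∃[ j ] h j # 0#
  nonzero-coordinate {h = h} h≉0 with any? (λ j → h j #? 0#)
  ... | yes p = p
  ... | no ¬p = ⊥-elim (h≉0 λ j → proj₁ (tight (h j) 0#) λ hj#0 → ¬p (j , hj#0))

  #0⇒nonzero : ∀ {h : Vector Carrier d} {j} → h j # 0# → Nonzero h
  #0⇒nonzero hj#0 h≈0 = #-irrefl (h≈0 _) hj#0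

  nonzero? : ∀ (l : Vector Carrier d) → (∀ j → l j ≈ 0#) ⊎ ∃[ j ] l j # 0#
  nonzero? l with any? (λ j → l j #? 0#)
  ... | yes p = inj₂ p
  ... | no ¬p = inj₁ λ j → proj₁ (tight (l j) 0#) λ lj#0 → ¬p (j , lj#0)

  ⟨⟩-congʳ : ∀ (l : Vector Carrier d) {x y} → x ≈ⱽ y → ⟨ l , x ⟩ ≈ ⟨ l , y ⟩
  ⟨⟩-congʳ l x≈y = sum-cong-≋ λ j → *-congˡ (x≈y j)

  ⟨⟩-zeroˡ : ∀ {l : Vector Carrier d} → l ≈ⱽ 0ⱽ → ∀ h → ⟨ l , h ⟩ ≈ 0#
  ⟨⟩-zeroˡ l≈0 h = sum-zero λ j → *-zeroˡ′ (h j) (l≈0 j)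

  ⟨⟩-zeroʳ : ∀ (l : Vector Carrier d) {h} → h ≈ⱽ 0ⱽ → ⟨ l , h ⟩ ≈ 0#
  ⟨⟩-zeroʳ l h≈0 = sum-zero λ j → *-zeroʳ′ (l j) (h≈0 j)

  ⟨⟩-comm : ∀ (l h : Vector Carrier d) → ⟨ l , h ⟩ ≈ ⟨ h , l ⟩
  ⟨⟩-comm l h = sum-cong-≋ λ j → *-comm (l j) (h j)

  ⟨⟩-linear : ∀ (l : Vector Carrier d) {a x y z} → (∀ j → z j ≈ a * x j + y j) →
              ⟨ l , z ⟩ ≈ a * ⟨ l , x ⟩ + ⟨ l , y ⟩
  ⟨⟩-linear l {a} {x} {y} {z} z≈ = begin
    sum (λ j → l j * z j)
      ≈⟨ sum-cong-≋ (λ j → trans (*-congˡ (z≈ j)) (rearrange (l j) a (x j) (y j))) ⟩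
    sum (λ j → a * (l j * x j) + l j * y j)
      ≈⟨ ∑-distrib-+ (λ j → a * (l j * x j)) (λ j → l j * y j) ⟩
    sum (λ j → a * (l j * x j)) + ⟨ l , y ⟩
      ≈⟨ +-congʳ (*-distribˡ-sum a (λ j → l j * x j)) ⟨
    a * ⟨ l , x ⟩ + ⟨ l , y ⟩ ∎
    where
    rearrange : ∀ l a x y → l * (a * x + y) ≈ a * (l * x) + l * y
    rearrange = solve 4 (λ l a x y → l :* (a :* x :+ y) := a :* (l :* x) :+ l :* y) refl

  -- A functional F stands for the polynomial f with F (h₁ ∷ ⋯ ∷ hₖ ∷ []) = (D_{h₁} ⋯ D_{hₖ} f)(0);
  -- then  F ∘ (h ∷_)  stands for D_h f.

  Word : ℕ → Set c
  Word d = List (Vector Carrier d)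

  Functional : ℕ → Set c
  Functional d = Word d → Carrier

  infix 4 _≋_
  _≋_ : Functional d → Functional d → Set (c Level.⊔ ℓ₁)
  F ≋ G = ∀ w → F w ≈ G w

  -- Linearity is stated for the first letter; `perm` carries it to the others. The hypothesis on
  -- `z` is pointwise, so it also yields invariance under `_≈ⱽ_`. The length of words with nonzero
  -- value is not bounded: an `IsForm` functional is a formal power series, and only homogeneous
  -- ones are turned back into polynomials.
  record IsForm (F : Functional d) : Set (c Level.⊔ ℓ₁) where
    field
      perm   : ∀ {v w} → v ↭ w → F v ≈ F w
      linear : ∀ {a x y z} → (∀ j → z j ≈ a * x j + y j) → ∀ w →
               F (z ∷ w) ≈ a * F (x ∷ w) + F (y ∷ w)

    headZero : ∀ {z} → z ≈ⱽ 0ⱽ → ∀ w → F (z ∷ w) ≈ 0#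
    headZero {z} z≈0 w = sym (+-cancelˡ (F (z ∷ w)) 0# (F (z ∷ w)) (begin
      F (z ∷ w) + 0#             ≈⟨ +-identityʳ _ ⟩
      F (z ∷ w)                  ≈⟨ linear {1#} {z} {z} z≈1z+z w ⟩
      1# * F (z ∷ w) + F (z ∷ w) ≈⟨ +-congʳ (*-identityˡ _) ⟩
      F (z ∷ w) + F (z ∷ w)      ∎))
      where
      z≈1z+z : ∀ j → z j ≈ 1# * z j + z j
      z≈1z+z j = trans (z≈0 j) (sym (+-zero (*-zeroʳ′ 1# (z≈0 j)) (z≈0 j)))

  open IsForm

  derivative-isForm : ∀ {F : Functional d} → IsForm F → ∀ h → IsForm (F ∘ (h ∷_))
  derivative-isForm F-form h .perm v↭w = perm F-form (prep h v↭w)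
  derivative-isForm {F = F} F-form h .linear {a} {x} {y} {z} z≈ w = begin
    F (h ∷ z ∷ w)                     ≈⟨ perm F-form (swap h z ↭refl) ⟩
    F (z ∷ h ∷ w)                     ≈⟨ linear F-form z≈ (h ∷ w) ⟩
    a * F (x ∷ h ∷ w) + F (y ∷ h ∷ w) ≈⟨ +-cong (*-congˡ (perm F-form (swap x h ↭refl))) (perm F-form (swap y h ↭refl)) ⟩
    a * F (h ∷ x ∷ w) + F (h ∷ y ∷ w) ∎

  zero-isForm : IsForm {d} (λ _ → 0#)
  zero-isForm .perm _ = refl
  zero-isForm .linear {a} _ _ = sym (+-zero (zeroʳ a) refl)

  axpy-isForm : ∀ {F G : Functional d} b → IsForm F → IsForm G → IsForm (λ w → b * F w + G w)
  axpy-isForm b F-form G-form .perm v↭w = +-cong (*-congˡ (perm F-form v↭w)) (perm G-form v↭w)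
  axpy-isForm {F = F} {G} b F-form G-form .linear {a} {x} {y} {z} z≈ w = begin
    b * F (z ∷ w) + G (z ∷ w)
      ≈⟨ +-cong (*-congˡ (linear F-form z≈ w)) (linear G-form z≈ w) ⟩
    b * (a * F (x ∷ w) + F (y ∷ w)) + (a * G (x ∷ w) + G (y ∷ w))
      ≈⟨ solve 6 (λ a b fx fy gx gy → b :* (a :* fx :+ fy) :+ (a :* gx :+ gy) := a :* (b :* fx :+ gx) :+ (b :* fy :+ gy))
           refl a b (F (x ∷ w)) (F (y ∷ w)) (G (x ∷ w)) (G (y ∷ w)) ⟩
    a * (b * F (x ∷ w) + G (x ∷ w)) + (b * F (y ∷ w) + G (y ∷ w)) ∎

  one : Functional d
  one []      = 1#
  one (_ ∷ _) = 0#

  one-isForm : IsForm (one {d})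
  one-isForm .perm v↭w = go v↭w
    where
    go : ∀ {v w} → v ↭ w → one {d} v ≈ one w
    go ↭refl        = refl
    go (prep _ _)   = refl
    go (swap _ _ _) = refl
    go (↭trans p q) = trans (go p) (go q)
  one-isForm .linear {a} _ _ = sym (+-zero (zeroʳ a) refl)

  -- Multiplication by a linear form

  -- The product l f vanishes at 0, and D_h (l f) = l(h) f + l D_h f.
  mul : Vector Carrier d → Functional d → Functional d
  mul l F []      = 0#
  mul l F (h ∷ w) = ⟨ l , h ⟩ * F w + mul l (F ∘ (h ∷_)) w

  -- `mul l F w` consults `F` only at words with one letter fewer than `w`. Inductions on the length
  -- of words, and the degree count for products, rest on this.
  mul-local : ∀ (l : Vector Carrier d) {F G} w → (∀ v → suc (length v) ≡ length w → F v ≈ G v) →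
              mul l F w ≈ mul l G w
  mul-local l []      F≈G = refl
  mul-local l (h ∷ w) F≈G = +-cong (*-congˡ (F≈G w ≡refl)) (mul-local l w λ v eq → F≈G (h ∷ v) (cong suc eq))

  mul-cong : ∀ (l : Vector Carrier d) {F G} → F ≋ G → mul l F ≋ mul l G
  mul-cong l F≋G w = mul-local l w λ v _ → F≋G v

  mul-zero : ∀ (l : Vector Carrier d) → mul l (λ _ → 0#) ≋ λ _ → 0#
  mul-zero l []      = refl
  mul-zero l (h ∷ w) = +-zero (zeroʳ _) (mul-zero l w)

  mul-linear : ∀ (l : Vector Carrier d) a F G → mul l (λ w → a * F w + G w) ≋ λ w → a * mul l F w + mul l G w
  mul-linear l a F G []      = sym (+-zero (zeroʳ a) refl)
  mul-linear l a F G (h ∷ w) = begin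
    ⟨ l , h ⟩ * (a * F w + G w) + mul l (λ v → a * F (h ∷ v) + G (h ∷ v)) w
      ≈⟨ +-congˡ (mul-linear l a (F ∘ (h ∷_)) (G ∘ (h ∷_)) w) ⟩
    ⟨ l , h ⟩ * (a * F w + G w) + (a * mul l (F ∘ (h ∷_)) w + mul l (G ∘ (h ∷_)) w)
      ≈⟨ solve 6 (λ s a f g f′ g′ → s :* (a :* f :+ g) :+ (a :* f′ :+ g′) := a :* (s :* f :+ f′) :+ (s :* g :+ g′))
           refl ⟨ l , h ⟩ a (F w) (G w) (mul l (F ∘ (h ∷_)) w) (mul l (G ∘ (h ∷_)) w) ⟩
    a * (⟨ l , h ⟩ * F w + mul l (F ∘ (h ∷_)) w) + (⟨ l , h ⟩ * G w + mul l (G ∘ (h ∷_)) w) ∎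

  mul-perm : ∀ (l : Vector Carrier d) {F} → IsForm F → ∀ {v w} → v ↭ w → mul l F v ≈ mul l F w
  mul-perm l F-form ↭refl        = refl
  mul-perm l F-form (prep h p)   = +-cong (*-congˡ (perm F-form p)) (mul-perm l (derivative-isForm F-form h) p)
  mul-perm l {F} F-form {_ ∷ _ ∷ v} {_ ∷ _ ∷ w} (swap x y p) = begin
    ⟨ l , x ⟩ * F (y ∷ v) + (⟨ l , y ⟩ * F (x ∷ v) + mul l (F ∘ (x ∷_) ∘ (y ∷_)) v)
      ≈⟨ solve 3 (λ a b c → a :+ (b :+ c) := b :+ (a :+ c)) refl _ _ _ ⟩
    ⟨ l , y ⟩ * F (x ∷ v) + (⟨ l , x ⟩ * F (y ∷ v) + mul l (F ∘ (x ∷_) ∘ (y ∷_)) v)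
      ≈⟨ +-cong (*-congˡ (perm F-form (prep x p))) (+-cong (*-congˡ (perm F-form (prep y p))) swapped) ⟩
    ⟨ l , y ⟩ * F (x ∷ w) + (⟨ l , x ⟩ * F (y ∷ w) + mul l (F ∘ (y ∷_) ∘ (x ∷_)) w) ∎
    where
    swapped = trans (mul-perm l (derivative-isForm (derivative-isForm F-form x) y) p)
                    (mul-cong l (λ u → perm F-form (swap x y ↭refl)) w)
  mul-perm l F-form (↭trans p q) = trans (mul-perm l F-form p) (mul-perm l F-form q)

  mul-isForm : ∀ (l : Vector Carrier d) {F} → IsForm F → IsForm (mul l F)
  mul-isForm l F-form .perm = mul-perm l F-form
  mul-isForm l {F} F-form .linear {a} {x} {y} {z} z≈ w = begin
    ⟨ l , z ⟩ * F w + mul l (F ∘ (z ∷_)) w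
      ≈⟨ +-cong (*-congʳ (⟨⟩-linear l z≈)) (trans (mul-cong l (linear F-form z≈) w) (mul-linear l a _ _ w)) ⟩
    (a * ⟨ l , x ⟩ + ⟨ l , y ⟩) * F w + (a * mul l (F ∘ (x ∷_)) w + mul l (F ∘ (y ∷_)) w)
      ≈⟨ solve 6 (λ a s t f p q → (a :* s :+ t) :* f :+ (a :* p :+ q) := a :* (s :* f :+ p) :+ (t :* f :+ q))
           refl a ⟨ l , x ⟩ ⟨ l , y ⟩ (F w) (mul l (F ∘ (x ∷_)) w) (mul l (F ∘ (y ∷_)) w) ⟩
    a * mul l F (x ∷ w) + mul l F (y ∷ w) ∎

  mul-map : ∀ {l : Vector Carrier d} {l′ : Vector Carrier e} (ι : Vector Carrier e → Vector Carrier d) →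
            (∀ x → ⟨ l , ι x ⟩ ≈ ⟨ l′ , x ⟩) → ∀ F w → mul l F (map ι w) ≈ mul l′ (F ∘ map ι) w
  mul-map ι l≈l′ F []      = refl
  mul-map ι l≈l′ F (x ∷ w) = +-cong (*-congʳ (l≈l′ x)) (mul-map ι l≈l′ (F ∘ (ι x ∷_)) w)

  mul-map-zero : ∀ {l : Vector Carrier d} (ι : Vector Carrier e → Vector Carrier d) →
                 (∀ x → ⟨ l , ι x ⟩ ≈ 0#) → ∀ F w → mul l F (map ι w) ≈ 0#
  mul-map-zero ι l≈0 F []      = refl
  mul-map-zero ι l≈0 F (x ∷ w) = +-zero (*-zeroˡ′ _ (l≈0 x)) (mul-map-zero ι l≈0 (F ∘ (ι x ∷_)) w)

  -- The Leibniz formula D_h^(m+1) (l f) = l D_h^(m+1) f + (m + 1) l(h) D_h^m f; further terms are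
  -- absent because l is linear.
  mul-replicate : ∀ (l h : Vector Carrier d) m F w →
    mul l F (replicate (suc m) h ++ w)
      ≈ mul l (λ v → F (replicate (suc m) h ++ v)) w + (suc m ×ᴷ ⟨ l , h ⟩) * F (replicate m h ++ w)
  mul-replicate l h zero    F w = begin
    ⟨ l , h ⟩ * F w + mul l (F ∘ (h ∷_)) w          ≈⟨ +-comm _ _ ⟩
    mul l (F ∘ (h ∷_)) w + ⟨ l , h ⟩ * F w          ≈⟨ +-congˡ (*-congʳ (+-identityʳ ⟨ l , h ⟩)) ⟨
    mul l (F ∘ (h ∷_)) w + (⟨ l , h ⟩ + 0#) * F w   ∎
  mul-replicate l h (suc m) F w = begin
    s * X + mul l (F ∘ (h ∷_)) (replicate (suc m) h ++ w)
      ≈⟨ +-congˡ (mul-replicate l h m (F ∘ (h ∷_)) w) ⟩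
    s * X + (M + (suc m ×ᴷ s) * X)
      ≈⟨ solve 4 (λ s t x m → s :* x :+ (m :+ t :* x) := m :+ (s :+ t) :* x) refl s (suc m ×ᴷ s) X M ⟩
    M + (s + suc m ×ᴷ s) * X ∎
    where
    s = ⟨ l , h ⟩
    X = F (replicate (suc m) h ++ w)
    M = mul l (λ v → F (replicate (suc (suc m)) h ++ v)) w

  mul-replicate-kernel : ∀ (l h : Vector Carrier d) → ⟨ l , h ⟩ ≈ 0# → ∀ m F w →
    mul l F (replicate m h ++ w) ≈ mul l (λ v → F (replicate m h ++ v)) w
  mul-replicate-kernel l h lh≈0 zero    F w = refl
  mul-replicate-kernel l h lh≈0 (suc m) F w = begin
    ⟨ l , h ⟩ * X + mul l (F ∘ (h ∷_)) (replicate m h ++ w) ≈⟨ +-congʳ (*-zeroˡ′ _ lh≈0) ⟩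
    0# + mul l (F ∘ (h ∷_)) (replicate m h ++ w)            ≈⟨ +-identityˡ _ ⟩
    mul l (F ∘ (h ∷_)) (replicate m h ++ w)                 ≈⟨ mul-replicate-kernel l h lh≈0 m (F ∘ (h ∷_)) w ⟩
    mul l (λ v → F (replicate (suc m) h ++ v)) w            ∎
    where
    X = F (replicate m h ++ w)

  -- Applying D_h to  l D_h U + (m + 1) l(h) U = 0  gives the same equation for D_h U with m + 1 in
  -- place of m.
  descent : ∀ (l h : Vector Carrier d) → ⟨ l , h ⟩ # 0# → ∀ m U →
            (∀ w → mul l (U ∘ (h ∷_)) w + (suc m ×ᴷ ⟨ l , h ⟩) * U w ≈ 0#) → ∀ w → U w ≈ 0#
  descent {d} l h lh#0 m U eq w = go (length w) m U eq w ≡refl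
    where
    s = ⟨ l , h ⟩
    -- `U` and `m` vary in the induction on the length `N` because the equation is passed to D_h U.
    -- At a word of length `N` the term l D_h U involves D_h U at shorter words only, where it
    -- vanishes by induction; what remains is divided by (m + 1) l(h), which is invertible in
    -- characteristic 0.
    go : ∀ N m U → (∀ w → mul l (U ∘ (h ∷_)) w + (suc m ×ᴷ s) * U w ≈ 0#) → ∀ w → length w ≡ N → U w ≈ 0#
    go zero    m U eq [] _ = *-cancelˡ-0 (suc×#0 m lh#0) (trans (sym (+-identityˡ _)) (eq []))
    go (suc N) m U eq w |w|≡ = *-cancelˡ-0 (suc×#0 m lh#0) (begin
      (suc m ×ᴷ s) * U w                        ≈⟨ +-identityˡ _ ⟨
      0# + (suc m ×ᴷ s) * U w                   ≈⟨ +-congʳ (trans (mul-local l w vanish) (mul-zero l w)) ⟨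
      mul l (U ∘ (h ∷_)) w + (suc m ×ᴷ s) * U w ≈⟨ eq w ⟩
      0#                                        ∎)
      where
      next : ∀ v → mul l (U ∘ (h ∷_) ∘ (h ∷_)) v + (suc (suc m) ×ᴷ s) * U (h ∷ v) ≈ 0#
      next v = trans (solve 4 (λ s t u q → q :+ (s :+ t) :* u := (s :* u :+ q) :+ t :* u)
                        refl s (suc m ×ᴷ s) (U (h ∷ v)) (mul l (U ∘ (h ∷_) ∘ (h ∷_)) v))
                     (eq (h ∷ v))
      vanish : ∀ v → suc (length v) ≡ length w → U (h ∷ v) ≈ 0#
      vanish v |v|≡ = go N (suc m) (U ∘ (h ∷_)) next v (ℕₚ.suc-injective (≡trans |v|≡ |w|≡))

  -- Differentiating l f = 0 along h gives l D_h f + l(h) f = 0, the equation of `descent` with m =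
  -- 0.
  mul-injective : ∀ (l h : Vector Carrier d) → ⟨ l , h ⟩ # 0# → ∀ F →
                  (∀ w → mul l F w ≈ 0#) → ∀ w → F w ≈ 0#
  mul-injective l h lh#0 F lF≈0 = descent l h lh#0 0 F λ w →
    trans (trans (+-congˡ (*-congʳ (+-identityʳ ⟨ l , h ⟩))) (+-comm _ _)) (lF≈0 (h ∷ w))

  isForm-resp : ∀ {F G : Functional d} → F ≋ G → IsForm F → IsForm G
  isForm-resp F≋G F-form .perm v↭w = trans (sym (F≋G _)) (trans (perm F-form v↭w) (F≋G _))
  isForm-resp F≋G F-form .linear z≈ w =
    trans (sym (F≋G _)) (trans (linear F-form z≈ w) (+-cong (*-congˡ (F≋G _)) (F≋G _)))

  scale-isForm : ∀ b {F : Functional d} → IsForm F → IsForm (λ w → b * F w)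
  scale-isForm b F-form = isForm-resp (λ w → +-identityʳ _) (axpy-isForm b F-form zero-isForm)

  -- Homogeneous functionals and division by a linear form

  Homogeneous : ℕ → Functional d → Set (c Level.⊔ ℓ₁)
  Homogeneous i F = ∀ w → length w ≢ i → F w ≈ 0#

  mul-homogeneous : ∀ (l : Vector Carrier d) {i F} → Homogeneous i F → Homogeneous (suc i) (mul l F)
  mul-homogeneous l F-hom w |w|≢ = trans
    (mul-local l w λ v |v|≡ → F-hom v λ |v|≡i → |w|≢ (≡trans (≡sym |v|≡) (cong suc |v|≡i)))
    (mul-zero l w)

  basisVector : Fin d → Vector Carrier d
  basisVector j i with does (i ≟ j)
  ... | true  = 1#
  ... | false = 0#

  basisVector-diag : ∀ (j : Fin d) → basisVector j j ≈ 1#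
  basisVector-diag j rewrite dec-true (j ≟ j) ≡refl = refl

  basisVector-off : ∀ {i j : Fin d} → i ≢ j → basisVector j i ≈ 0#
  basisVector-off {i = i} {j} i≢j rewrite dec-false (i ≟ j) i≢j = refl

  ⟨⟩-basisVector : ∀ (l : Vector Carrier d) j → ⟨ l , basisVector j ⟩ ≈ l j
  ⟨⟩-basisVector l j = trans
    (sum-single (λ i → l i * basisVector j i) j λ i i≢j → *-zeroʳ′ (l i) (basisVector-off i≢j))
    (trans (*-congˡ (basisVector-diag j)) (*-identityʳ (l j)))

  -1*x+x≈0 : ∀ x → - 1# * x + x ≈ 0#
  -1*x+x≈0 x = trans (+-congʳ (-1*x≈-x x)) (-‿inverseˡ x)

  -- inverse i k u F  is  (k + 1 + l D_u)⁻¹ F  for F homogeneous of degree i and l(u) = 1.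
  inverse : ℕ → ℕ → (l u : Vector Carrier d) → Functional d → Functional d
  inverse zero    k l u F w = proj₁ (reciprocal (suc×1#0 k)) * F w
  inverse (suc i) k l u F w = - κ * mul l (inverse i (suc k) l u (F ∘ (u ∷_))) w + κ * F w
    where κ = proj₁ (reciprocal (suc×1#0 k))

  inverse-isForm : ∀ i k (l u : Vector Carrier d) {F} → IsForm F → IsForm (inverse i k l u F)
  inverse-isForm zero    k l u F-form = scale-isForm _ F-form
  inverse-isForm (suc i) k l u F-form = axpy-isForm _
    (mul-isForm l (inverse-isForm i (suc k) l u (derivative-isForm F-form u))) (scale-isForm _ F-form)

  inverse-homogeneous : ∀ i k (l u : Vector Carrier d) {F} → Homogeneous i F → Homogeneous i (inverse i k l u F)
  inverse-homogeneous zero    k l u F-hom w |w|≢ = *-zeroʳ′ _ (F-hom w |w|≢)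
  inverse-homogeneous (suc i) k l u F-hom w |w|≢ = +-zero
    (*-zeroʳ′ _ (mul-homogeneous l (inverse-homogeneous i (suc k) l u λ v |v|≢ →
      F-hom (u ∷ v) (|v|≢ ∘ ℕₚ.suc-injective)) w |w|≢))
    (*-zeroʳ′ _ (F-hom w |w|≢))

  -- From l(u) = 1 follows D_u (k + 1 + l D_u) = (k + 2 + l D_u) D_u. Hence the derivative along u
  -- of the solution must be G = (k + 2 + l D_u)⁻¹ D_u F, which has lower degree, and the solution
  -- itself is (F - l G) / (k + 1). The local `derivative` checks that its derivative is indeed G.
  inverse-correct : ∀ (l u : Vector Carrier d) → ⟨ l , u ⟩ ≈ 1# → ∀ i k F → Homogeneous i F → ∀ w →
    (suc k ×ᴷ 1#) * inverse i k l u F w + mul l (inverse i k l u F ∘ (u ∷_)) w ≈ F w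
  inverse-correct l u lu≈1 zero k F F-hom w = begin
    N * (κ * F w) + mul l (λ v → κ * F (u ∷ v)) w
      ≈⟨ +-congˡ (trans (mul-cong l (λ v → *-zeroʳ′ κ (F-hom (u ∷ v) λ ())) w) (mul-zero l w)) ⟩
    N * (κ * F w) + 0#  ≈⟨ +-identityʳ _ ⟩
    N * (κ * F w)       ≈⟨ solve 3 (λ n k f → n :* (k :* f) := (k :* n) :* f) refl N κ (F w) ⟩
    κ * N * F w         ≈⟨ *-congʳ (proj₂ (reciprocal (suc×1#0 k))) ⟩
    1# * F w            ≈⟨ *-identityˡ (F w) ⟩
    F w                 ∎
    where
    N = suc k ×ᴷ 1#
    κ = proj₁ (reciprocal (suc×1#0 k))
  inverse-correct l u lu≈1 (suc i) k F F-hom w = begin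
    N * (- κ * lG + κ * F w) + mul l (inverse (suc i) k l u F ∘ (u ∷_)) w
      ≈⟨ +-congˡ (mul-cong l derivative w) ⟩
    N * (- κ * lG + κ * F w) + lG
      ≈⟨ solve 5 (λ n k k′ g f → n :* (k′ :* g :+ k :* f) :+ g := k′ :* n :* g :+ g :+ k :* n :* f)
           refl N κ (- κ) lG (F w) ⟩
    - κ * N * lG + lG + κ * N * F w
      ≈⟨ +-cong (+-congʳ (*-congʳ -κN≈-1)) (*-congʳ κN≈1) ⟩
    - 1# * lG + lG + 1# * F w
      ≈⟨ +-cong (-1*x+x≈0 lG) (*-identityˡ (F w)) ⟩
    0# + F w
      ≈⟨ +-identityˡ (F w) ⟩
    F w ∎
    where
    N = suc k ×ᴷ 1#
    κ = proj₁ (reciprocal (suc×1#0 k))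
    G = inverse i (suc k) l u (F ∘ (u ∷_))
    lG = mul l G w
    κN≈1 : κ * N ≈ 1#
    κN≈1 = proj₂ (reciprocal (suc×1#0 k))
    -κN≈-1 : - κ * N ≈ - 1#
    -κN≈-1 = trans (sym (-‿distribˡ-* κ N)) (-‿cong κN≈1)
    G-equation : ∀ v → (suc (suc k) ×ᴷ 1#) * G v + mul l (G ∘ (u ∷_)) v ≈ F (u ∷ v)
    G-equation = inverse-correct l u lu≈1 i (suc k) (F ∘ (u ∷_)) λ v |v|≢ → F-hom (u ∷ v) (|v|≢ ∘ ℕₚ.suc-injective)
    derivative : ∀ v → inverse (suc i) k l u F (u ∷ v) ≈ G v
    derivative v = begin
      - κ * P + κ * F (u ∷ v)
        ≈⟨ +-congˡ (*-congˡ (G-equation v)) ⟨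
      - κ * P + κ * ((1# + N) * G v + M)
        ≈⟨ +-congˡ (*-congˡ (solve 4 (λ o n g m → (o :+ n) :* g :+ m := (o :* g :+ m) :+ n :* g) refl 1# N (G v) M)) ⟩
      - κ * P + κ * ((1# * G v + M) + N * G v)
        ≈⟨ +-congˡ (*-congˡ (+-congʳ (+-congʳ (*-congʳ lu≈1)))) ⟨
      - κ * P + κ * (P + N * G v)
        ≈⟨ solve 5 (λ k k′ p n g → k′ :* p :+ k :* (p :+ n :* g) := (k′ :* p :+ k :* p) :+ k :* n :* g)
             refl κ (- κ) P N (G v) ⟩
      (- κ * P + κ * P) + κ * N * G v
        ≈⟨ +-cong (trans (+-congʳ (sym (-‿distribˡ-* κ P))) (-‿inverseˡ (κ * P))) (*-congʳ κN≈1) ⟩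
      0# + 1# * G v
        ≈⟨ trans (+-identityˡ _) (*-identityˡ (G v)) ⟩
      G v ∎
      where
      M = mul l (G ∘ (u ∷_)) v
      P = ⟨ l , u ⟩ * G v + M

  coordinatewise : ∀ {p} {P : Fin (suc d) → Set p} j → P j → (∀ k → P (punchIn j k)) → ∀ i → P i
  coordinatewise {P = P} j Pj Pk i with j ≟ i
  ... | yes ≡refl = Pj
  ... | no j≢i    = subst P (punchIn-punchOut j≢i) (Pk (punchOut j≢i))

  module Hyperplane {d} (l : Vector Carrier (suc d)) (j : Fin (suc d)) (lj#0 : l j # 0#) where

    private
      s = proj₁ (reciprocal lj#0)

      slj≈1 : s * l j ≈ 1#
      slj≈1 = proj₂ (reciprocal lj#0)

      -slj≈-1 : - s * l j ≈ - 1#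
      -slj≈-1 = trans (sym (-‿distribˡ-* s (l j))) (-‿cong slj≈1)

      ⟨⟩-remove : ∀ (m h : Vector Carrier (suc d)) → ⟨ m , h ⟩ ≈ m j * h j + ⟨ removeAt m j , removeAt h j ⟩
      ⟨⟩-remove m h = sum-remove λ i → m i * h i

    -- The parametrization of the hyperplane l = 0 by the coordinates other than the j-th.
    embed : Vector Carrier d → Vector Carrier (suc d)
    embed x = insertAt x j (- s * ⟨ removeAt l j , x ⟩)

    embed-j : ∀ x → embed x j ≈ - s * ⟨ removeAt l j , x ⟩
    embed-j x = reflexive (Vectorₚ.insertAt-lookup x j _)

    embed-punchIn : ∀ x k → embed x (punchIn j k) ≈ x k
    embed-punchIn x k = reflexive (Vectorₚ.insertAt-punchIn x j _ k)

    -- The transpose of `embed`: m - (m_j / l_j) l with its vanishing j-th coordinate dropped.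
    pullback : Vector Carrier (suc d) → Vector Carrier d
    pullback m k = m j * - s * l (punchIn j k) + m (punchIn j k)

    embed-pullback : ∀ m x → ⟨ m , embed x ⟩ ≈ ⟨ pullback m , x ⟩
    embed-pullback m x = begin
      ⟨ m , embed x ⟩
        ≈⟨ ⟨⟩-remove m (embed x) ⟩
      m j * embed x j + ⟨ removeAt m j , removeAt (embed x) j ⟩
        ≈⟨ +-cong (*-congˡ (embed-j x)) (⟨⟩-congʳ (removeAt m j) (embed-punchIn x)) ⟩
      m j * (- s * ⟨ removeAt l j , x ⟩) + ⟨ removeAt m j , x ⟩
        ≈⟨ +-congʳ (*-assoc (m j) (- s) _) ⟨
      m j * - s * ⟨ removeAt l j , x ⟩ + ⟨ removeAt m j , x ⟩
        ≈⟨ +-cong (*-congˡ (⟨⟩-comm _ x)) (⟨⟩-comm _ x) ⟩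
      m j * - s * ⟨ x , removeAt l j ⟩ + ⟨ x , removeAt m j ⟩
        ≈⟨ ⟨⟩-linear x (λ k → refl) ⟨
      ⟨ x , pullback m ⟩
        ≈⟨ ⟨⟩-comm x (pullback m) ⟩
      ⟨ pullback m , x ⟩ ∎

    embed-kernel : ∀ x → ⟨ l , embed x ⟩ ≈ 0#
    embed-kernel x = trans (embed-pullback l x) (⟨⟩-zeroˡ (λ k →
      trans (+-congʳ (*-congʳ (trans (*-comm (l j) (- s)) -slj≈-1))) (-1*x+x≈0 _)) x)

    embed-linear : ∀ {a x y z} → (∀ k → z k ≈ a * x k + y k) → ∀ i → embed z i ≈ a * embed x i + embed y i
    embed-linear {a} {x} {y} {z} z≈ = coordinatewise j
      (begin
        embed z j
          ≈⟨ embed-j z ⟩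
        - s * ⟨ l′ , z ⟩
          ≈⟨ *-congˡ (⟨⟩-linear l′ z≈) ⟩
        - s * (a * ⟨ l′ , x ⟩ + ⟨ l′ , y ⟩)
          ≈⟨ solve 4 (λ s a x y → s :* (a :* x :+ y) := a :* (s :* x) :+ s :* y) refl (- s) a ⟨ l′ , x ⟩ ⟨ l′ , y ⟩ ⟩
        a * (- s * ⟨ l′ , x ⟩) + - s * ⟨ l′ , y ⟩
          ≈⟨ +-cong (*-congˡ (embed-j x)) (embed-j y) ⟨
        a * embed x j + embed y j ∎)
      (λ k → trans (embed-punchIn z k) (trans (z≈ k)
        (+-cong (*-congˡ (sym (embed-punchIn x k))) (sym (embed-punchIn y k)))))
      where l′ = removeAt l j

    embed-nonzero : ∀ {x} → Nonzero x → Nonzero (embed x)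
    embed-nonzero {x} x≉0 ιx≈0 = x≉0 λ k → trans (sym (embed-punchIn x k)) (ιx≈0 (punchIn j k))

    embed-zero : ∀ {x} → x ≈ⱽ 0ⱽ → embed x ≈ⱽ 0ⱽ
    embed-zero {x} x≈0 = coordinatewise j
      (trans (embed-j x) (*-zeroʳ′ _ (⟨⟩-zeroʳ (removeAt l j) x≈0)))
      (λ k → trans (embed-punchIn x k) (x≈0 k))

    embed-removeAt : ∀ {h} → ⟨ l , h ⟩ ≈ 0# → h ≈ⱽ embed (removeAt h j)
    embed-removeAt {h} lh≈0 = coordinatewise j
      (trans (begin
        h j                                  ≈⟨ +-identityʳ (h j) ⟨
        h j + 0#                             ≈⟨ +-congˡ (trans (*-congˡ (trans (sym (⟨⟩-remove l h)) lh≈0)) (zeroʳ (- s))) ⟨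
        h j + - s * (l j * h j + L)          ≈⟨ solve 4 (λ s l h m → h :+ s :* (l :* h :+ m) := (s :* l :* h :+ h) :+ s :* m)
                                                  refl (- s) (l j) (h j) L ⟩
        (- s * l j * h j + h j) + - s * L    ≈⟨ +-congʳ (trans (+-congʳ (*-congʳ -slj≈-1)) (-1*x+x≈0 (h j))) ⟩
        0# + - s * L                         ≈⟨ +-identityˡ _ ⟩
        - s * L                              ∎)
        (sym (embed-j (removeAt h j))))
      (λ k → sym (embed-punchIn (removeAt h j) k))
      where
      L = ⟨ removeAt l j , removeAt h j ⟩

    transversal : Vector Carrier (suc d)
    transversal i = s * basisVector j i

    ⟨⟩-transversal : ⟨ l , transversal ⟩ ≈ 1#
    ⟨⟩-transversal = trans (⟨⟩-linear l {s} {basisVector j} {0ⱽ} (λ i → sym (+-identityʳ _)))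
      (trans (+-cong (*-congˡ (⟨⟩-basisVector l j)) (⟨⟩-zeroʳ l (λ _ → refl)))
        (trans (+-identityʳ _) slj≈1))

  module _ {d} {l : Vector Carrier (suc d)} {j} (lj#0 : l j # 0#) where
    open Hyperplane l j lj#0

    -- V is the sum of the line of `transversal` and the hyperplane. Each letter splits accordingly
    -- as `⟨ l , h ⟩` times `transversal` plus some `embed y`; the first part contributes 0, and the
    -- second is absorbed into the functional.
    form-unique : ∀ {F} → IsForm F → (∀ w → F (transversal ∷ w) ≈ 0#) → (∀ w → F (map embed w) ≈ 0#) →
                  ∀ w → F w ≈ 0#
    form-unique F-form Fu≈0 F∣≈0 [] = F∣≈0 []
    form-unique {F} F-form Fu≈0 F∣≈0 (h ∷ w) = begin
      F (h ∷ w)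
        ≈⟨ linear F-form decompose w ⟩
      ⟨ l , h ⟩ * F (transversal ∷ w) + F (embed y ∷ w)
        ≈⟨ +-cong (*-zeroʳ′ _ (Fu≈0 w)) (form-unique (derivative-isForm F-form (embed y))
             (λ v → trans (perm F-form (swap _ _ ↭refl)) (Fu≈0 (embed y ∷ v))) (λ v → F∣≈0 (y ∷ v)) w) ⟩
      0# + 0#
        ≈⟨ +-identityˡ 0# ⟩
      0# ∎
      where
      h′ y : Vector Carrier _
      h′ i = - ⟨ l , h ⟩ * transversal i + h i
      y = removeAt h′ j
      lh′≈0 : ⟨ l , h′ ⟩ ≈ 0#
      lh′≈0 = trans (⟨⟩-linear l {a = - ⟨ l , h ⟩} {x = transversal} {y = h} (λ _ → refl))
        (trans (+-congʳ (trans (*-congˡ ⟨⟩-transversal) (*-identityʳ _))) (-‿inverseˡ _))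
      decompose : ∀ i → h i ≈ ⟨ l , h ⟩ * transversal i + embed y i
      decompose i = begin
        h i                         ≈⟨ +-identityˡ (h i) ⟨
        0# + h i                    ≈⟨ +-congʳ (trans (+-congˡ (sym (-‿distribˡ-* _ _))) (-‿inverseʳ _)) ⟨
        (p + - ⟨ l , h ⟩ * transversal i) + h i ≈⟨ +-assoc _ _ _ ⟩
        p + h′ i                    ≈⟨ +-congˡ (embed-removeAt lh′≈0 i) ⟩
        p + embed y i               ∎
        where p = ⟨ l , h ⟩ * transversal i

    -- A quotient must satisfy D_u F = D_u (l G) = (1 + l D_u) G, which determines G and explains
    -- the value k = 0 in `inverse`. The remainder F - l G then has zero derivative along u and
    -- vanishes on the hyperplane, so `form-unique` applies.
    divide : ∀ {i F} → IsForm F → Homogeneous (suc i) F → (∀ w → F (map embed w) ≈ 0#) →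
             ∃[ G ] IsForm G × Homogeneous i G × F ≋ mul l G
    divide {i} {F} F-form F-hom F∣≈0 = G , G-form , inverse-homogeneous i 0 l u uF-hom , F≋lG
      where
      u = transversal
      uF-form = derivative-isForm F-form u
      uF-hom : Homogeneous i (F ∘ (u ∷_))
      uF-hom v |v|≢ = F-hom (u ∷ v) (|v|≢ ∘ ℕₚ.suc-injective)
      G = inverse i 0 l u (F ∘ (u ∷_))
      G-form = inverse-isForm i 0 l u uF-form
      R : Functional _
      R w = - 1# * mul l G w + F w
      Ru≈0 : ∀ w → R (u ∷ w) ≈ 0#
      Ru≈0 w = trans (+-congʳ (*-congˡ (trans (+-congʳ (*-congʳ (trans ⟨⟩-transversal (sym (+-identityʳ 1#)))))
        (inverse-correct l u ⟨⟩-transversal i 0 (F ∘ (u ∷_)) uF-hom w)))) (-1*x+x≈0 _)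
      R≈0 : ∀ w → R w ≈ 0#
      R≈0 = form-unique (axpy-isForm (- 1#) (mul-isForm l G-form) F-form) Ru≈0
        λ w → +-zero (*-zeroʳ′ _ (mul-map-zero embed embed-kernel G w)) (F∣≈0 w)
      F≋lG : F ≋ mul l G
      F≋lG w = begin
        F w                                    ≈⟨ +-identityˡ _ ⟨
        0# + F w                               ≈⟨ +-congʳ (trans (+-congˡ (-1*x≈-x _)) (-‿inverseʳ _)) ⟨
        (mul l G w + - 1# * mul l G w) + F w   ≈⟨ +-assoc _ _ _ ⟩
        mul l G w + R w                        ≈⟨ +-congˡ (R≈0 w) ⟩
        mul l G w + 0#                         ≈⟨ +-identityʳ _ ⟩
        mul l G w                              ∎

  -- Powers of directional derivatives

  length-filter-cong : ∀ {a b p q} {A : Set a} {B : Set b} {P : A → Set p} {Q : B → Set q}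
    (P? : ∀ x → Dec (P x)) (Q? : ∀ y → Dec (Q y)) (f : Fin n → A) (g : Fin n → B) →
    (∀ i → does (P? (f i)) ≡ does (Q? (g i))) →
    length (filter P? (tabulate f)) ≡ length (filter Q? (tabulate g))
  length-filter-cong {zero}  P? Q? f g P≡Q = ≡refl
  length-filter-cong {suc n} P? Q? f g P≡Q with does (P? (f zero)) | does (Q? (g zero)) | P≡Q zero
  ... | true  | true  | _ = cong suc (length-filter-cong P? Q? (f ∘ suc) (g ∘ suc) (P≡Q ∘ suc))
  ... | false | false | _ = length-filter-cong P? Q? (f ∘ suc) (g ∘ suc) (P≡Q ∘ suc)

  #0-cong : ∀ {x y} → x ≈ y → does (x #? 0#) ≡ does (y #? 0#)
  #0-cong {x} {y} x≈y = does-⇔ (mk⇔ (#-congʳ x≈y) (#-congʳ (sym x≈y))) (x #? 0#) (y #? 0#)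

  ρ-cong : ∀ (A : Forms d n) (B : Forms e n) {h x} → (∀ i → ⟨ A i , h ⟩ ≈ ⟨ B i , x ⟩) → ρ A h ≡ ρ B x
  ρ-cong A B {h} {x} A≈B =
    length-filter-cong (λ i → ⟨ A i , h ⟩ #? 0#) (λ i → ⟨ B i , x ⟩ #? 0#) id id (#0-cong ∘ A≈B)

  ρ-tail : ∀ (A : Forms d (suc n)) h →
    length (filter (λ i → ⟨ A i , h ⟩ #? 0#) (tabulate suc)) ≡ ρ (A ∘ suc) h
  ρ-tail A h = length-filter-cong (λ i → ⟨ A i , h ⟩ #? 0#) (λ i → ⟨ A (suc i) , h ⟩ #? 0#) suc id λ _ → ≡refl

  ρ-hit : ∀ (A : Forms d (suc n)) {h} → ⟨ A zero , h ⟩ # 0# → ρ A h ≡ suc (ρ (A ∘ suc) h)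
  ρ-hit A {h} Ah#0 rewrite dec-true (⟨ A zero , h ⟩ #? 0#) Ah#0 = cong suc (ρ-tail A h)

  ρ-miss : ∀ (A : Forms d (suc n)) {h} → ⟨ A zero , h ⟩ ≈ 0# → ρ A h ≡ ρ (A ∘ suc) h
  ρ-miss A {h} Ah≈0 rewrite dec-false (⟨ A zero , h ⟩ #? 0#) (#-irrefl Ah≈0) = ρ-tail A h

  replicate-∷ʳ : ∀ {a} {A : Set a} m (h : A) w → replicate m h ++ h ∷ w ≡ replicate (suc m) h ++ w
  replicate-∷ʳ zero    h w = ≡refl
  replicate-∷ʳ (suc m) h w = cong (h ∷_) (replicate-∷ʳ m h w)

  -- The polynomial of F is annihilated by the m-th power of D_h.
  Kills : Vector Carrier d → ℕ → Functional d → Set (c Level.⊔ ℓ₁)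
  Kills h m F = ∀ w → F (replicate m h ++ w) ≈ 0#

  kills-suc : ∀ {h : Vector Carrier d} {m F} → Kills h m F → Kills h (suc m) F
  kills-suc {h = h} {m} {F} kills w =
    trans (reflexive (cong F (≡sym (replicate-∷ʳ m h w)))) (kills (h ∷ w))

  kills-mul : ∀ (l : Vector Carrier d) {h m F} → Kills h m F → Kills h (suc m) (mul l F)
  kills-mul l {h} {m} {F} kills w = trans (mul-replicate l h m F w) (+-zero
    (trans (mul-cong l (kills-suc {F = F} kills) w) (mul-zero l w)) (*-zeroʳ′ _ (kills w)))

  kills-mul-kernel : ∀ (l : Vector Carrier d) {h m F} → ⟨ l , h ⟩ ≈ 0# → Kills h m F → Kills h m (mul l F)
  kills-mul-kernel l {h} {m} {F} lh≈0 kills w =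
    trans (mul-replicate-kernel l h lh≈0 m F w) (trans (mul-cong l kills w) (mul-zero l w))

  -- With U = D_h^m f, the Leibniz formula turns D_h^(m+1) (l f) = 0 into the equation of `descent`.
  mul-kills : ∀ (l : Vector Carrier d) {h m F} → ⟨ l , h ⟩ # 0# → Kills h (suc m) (mul l F) → Kills h m F
  mul-kills l {h} {m} {F} lh#0 kills = descent l h lh#0 m (λ v → F (replicate m h ++ v)) λ w →
    trans (+-congʳ (mul-cong l (λ v → reflexive (cong F (replicate-∷ʳ m h v))) w))
          (trans (sym (mul-replicate l h m F w)) (kills w))

  -- Here D_h commutes with multiplication by l, so l D_h^m f = 0. To cancel l a direction u off the
  -- hyperplane is required, because h lies on it.
  mul-kills-kernel : ∀ (l u : Vector Carrier d) {h m F} → ⟨ l , u ⟩ # 0# → ⟨ l , h ⟩ ≈ 0# →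
                     Kills h m (mul l F) → Kills h m F
  mul-kills-kernel l u {h} {m} {F} lu#0 lh≈0 kills = mul-injective l u lu#0 (λ v → F (replicate m h ++ v))
    λ w → trans (sym (mul-replicate-kernel l h lh≈0 m F w)) (kills w)

  -- Membership in C and products of forms

  InC : Forms d n → Functional d → Set (c Level.⊔ ℓ₁)
  InC A F = ∀ h → Nonzero h → Kills h (ρ A h) F

  InC-mul⁻ : ∀ (A : Forms d (suc n)) {j F} → A zero j # 0# → InC A (mul (A zero) F) → InC (A ∘ suc) F
  InC-mul⁻ {suc d} A {j} {F} Aj#0 F∈C h h≉0 with ≈0⊎#0 ⟨ A zero , h ⟩
  ... | inj₁ Ah≈0 = mul-kills-kernel (A zero) transversal {h} {F = F} (#-congʳ (sym ⟨⟩-transversal) 1#0) Ah≈0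
    (subst (λ m → Kills h m (mul (A zero) F)) (ρ-miss A {h} Ah≈0) (F∈C h h≉0))
    where open Hyperplane (A zero) j Aj#0
  ... | inj₂ Ah#0 = mul-kills (A zero) {h} {F = F} Ah#0
    (subst (λ m → Kills h m (mul (A zero) F)) (ρ-hit A {h} Ah#0) (F∈C h h≉0))

  prod : Forms d n → Subset n → Functional d
  prod A []            = one
  prod A (outside ∷ S) = prod (A ∘ suc) S
  prod A (inside ∷ S)  = mul (A zero) (prod (A ∘ suc) S)

  prod-isForm : ∀ (A : Forms d n) S → IsForm (prod A S)
  prod-isForm A []            = one-isForm
  prod-isForm A (outside ∷ S) = prod-isForm (A ∘ suc) S
  prod-isForm A (inside ∷ S)  = mul-isForm (A zero) (prod-isForm (A ∘ suc) S)

  prod-homogeneous : ∀ (A : Forms d n) S → Homogeneous ∣ S ∣ (prod A S)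
  prod-homogeneous A []            []      |w|≢ = ⊥-elim (|w|≢ ≡refl)
  prod-homogeneous A []            (h ∷ w) _    = refl
  prod-homogeneous A (outside ∷ S) = prod-homogeneous (A ∘ suc) S
  prod-homogeneous A (inside ∷ S)  = mul-homogeneous (A zero) (prod-homogeneous (A ∘ suc) S)

  prod-map : ∀ (A : Forms d n) (B : Forms e n) ι → (∀ i x → ⟨ A i , ι x ⟩ ≈ ⟨ B i , x ⟩) →
             ∀ S w → prod A S (map ι w) ≈ prod B S w
  prod-map A B ι A≈B []            []      = refl
  prod-map A B ι A≈B []            (x ∷ w) = refl
  prod-map A B ι A≈B (outside ∷ S) w = prod-map (A ∘ suc) (B ∘ suc) ι (A≈B ∘ suc) S w
  prod-map A B ι A≈B (inside ∷ S)  w =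
    trans (mul-map ι (A≈B zero) (prod (A ∘ suc) S) w)
          (mul-cong (B zero) (prod-map (A ∘ suc) (B ∘ suc) ι (A≈B ∘ suc) S) w)

  -- Along h, a factor raises the degree by one if it is nonzero at h and by nothing otherwise, so
  -- the degree of the product is at most ρ(h).
  prod-kills-suc : ∀ (A : Forms d n) S h → Kills h (suc (ρ A h)) (prod A S)
  prod-kills-suc A [] h w = refl
  prod-kills-suc A (x ∷ S) h with ≈0⊎#0 ⟨ A zero , h ⟩
  prod-kills-suc A (outside ∷ S) h | inj₁ Ah≈0 rewrite ρ-miss A Ah≈0 = prod-kills-suc (A ∘ suc) S h
  prod-kills-suc A (inside ∷ S)  h | inj₁ Ah≈0 rewrite ρ-miss A Ah≈0 =
    kills-mul-kernel (A zero) {F = prod (A ∘ suc) S} Ah≈0 (prod-kills-suc (A ∘ suc) S h)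
  prod-kills-suc A (outside ∷ S) h | inj₂ Ah#0 rewrite ρ-hit A Ah#0 =
    kills-suc {F = prod (A ∘ suc) S} (prod-kills-suc (A ∘ suc) S h)
  prod-kills-suc A (inside ∷ S)  h | inj₂ Ah#0 rewrite ρ-hit A Ah#0 =
    kills-mul (A zero) {F = prod (A ∘ suc) S} (prod-kills-suc (A ∘ suc) S h)

  -- Required for all nonzero h, this says that the complement of `S` spans. For a single h it
  -- provides a form counted by ρ(h) but absent from the product, which improves the bound on the
  -- degree along h by one.
  Avoids : Forms d n → Subset n → Vector Carrier d → Set ℓ₂
  Avoids A S h = ∃[ i ] lookup S i ≡ outside × ⟨ A i , h ⟩ # 0#

  prod-kills : ∀ (A : Forms d n) S {h} → Avoids A S h → Kills h (ρ A h) (prod A S)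
  prod-kills A (outside ∷ S) {h} (zero , _ , Ah#0) rewrite ρ-hit A Ah#0 = prod-kills-suc (A ∘ suc) S h
  prod-kills A (x ∷ S) {h} (suc i , i∉S , Aih#0) with ≈0⊎#0 ⟨ A zero , h ⟩
  prod-kills A (outside ∷ S) (suc i , i∉S , Aih#0) | inj₁ Ah≈0 rewrite ρ-miss A Ah≈0 =
    prod-kills (A ∘ suc) S (i , i∉S , Aih#0)
  prod-kills A (inside ∷ S)  (suc i , i∉S , Aih#0) | inj₁ Ah≈0 rewrite ρ-miss A Ah≈0 =
    kills-mul-kernel (A zero) {F = prod (A ∘ suc) S} Ah≈0 (prod-kills (A ∘ suc) S (i , i∉S , Aih#0))
  prod-kills A (outside ∷ S) (suc i , i∉S , Aih#0) | inj₂ Ah#0 rewrite ρ-hit A Ah#0 =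
    kills-suc {F = prod (A ∘ suc) S} (prod-kills (A ∘ suc) S (i , i∉S , Aih#0))
  prod-kills A (inside ∷ S)  (suc i , i∉S , Aih#0) | inj₂ Ah#0 rewrite ρ-hit A Ah#0 =
    kills-mul (A zero) {F = prod (A ∘ suc) S} (prod-kills (A ∘ suc) S (i , i∉S , Aih#0))

  -- A basis consisting of products of forms

  contraction : ∀ (A : Forms (suc d) (suc n)) {j} → A zero j # 0# → Forms d n
  contraction A {j} Aj#0 i = Hyperplane.pullback (A zero) j Aj#0 (A (suc i))

  -- The link between a tree and actual forms. Keeping it apart from `DCTree` lets `hilb`, `spans`
  -- and `basis` be plain functions of the tree.
  data Eliminates : DCTree d n → Forms d n → Set (c Level.⊔ ℓ₁ Level.⊔ ℓ₂) where
    point : ∀ {A : Forms 0 0} → Eliminates point A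
    flat  : ∀ {A : Forms (suc d) 0} → Eliminates flat A
    loop  : ∀ {t} {A : Forms d (suc n)} → A zero ≈ⱽ 0ⱽ → Eliminates t (A ∘ suc) → Eliminates (loop t) A
    pivot : ∀ {t t′} {A : Forms (suc d) (suc n)} {j} (Aj#0 : A zero j # 0#) →
            Eliminates t (A ∘ suc) → Eliminates t′ (contraction A Aj#0) → Eliminates (pivot t t′) A

  eliminate : ∀ (A : Forms d n) → ∃[ t ] Eliminates t A
  eliminate {zero}  {zero}  A = point , point
  eliminate {suc d} {zero}  A = flat , flat
  eliminate {d}     {suc n} A with nonzero? (A zero)
  eliminate {d}     {suc n} A | inj₁ A₀≈0 with eliminate (A ∘ suc)
  ... | t , elim = loop t , loop A₀≈0 elim
  eliminate {suc d} {suc n} A | inj₂ (j , Aj#0) with eliminate (A ∘ suc) | eliminate (contraction A Aj#0)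
  ... | t , elim | t′ , elim′ = pivot t t′ , pivot Aj#0 elim elim′

  suspended : ∀ {a} → (∀ i → Vector (Subset n) (a i)) → ∀ i → Vector (Subset (suc n)) (suspend a i)
  suspended S (suc i) k = inside ∷ S i k

  basis : ∀ (t : DCTree d n) i → Vector (Subset n) (hilb t i)
  basis point        zero _ = []
  basis (loop t)     i k    = outside ∷ basis t i k
  basis (pivot t t′) i      = suspended (basis t) i Vector.++ λ k → outside ∷ basis t′ i k

  ++-all : ∀ {a p} {A : Set a} {P : A → Set p} {k} (xs : Vector A m) (ys : Vector A k) →
           (∀ i → P (xs i)) → (∀ i → P (ys i)) → ∀ i → P ((xs Vector.++ ys) i)
  ++-all {m = m} xs ys Pxs Pys i with splitAt m i
  ... | inj₁ i′ = Pxs i′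
  ... | inj₂ i′ = Pys i′

  basis-size : ∀ (t : DCTree d n) i k → ∣ basis t i k ∣ ≡ i
  basis-size point        zero k = ≡refl
  basis-size (loop t)     i    k = basis-size t i k
  basis-size (pivot t t′) i      = ++-all {P = λ S → ∣ S ∣ ≡ i} (suspended (basis t) i) _
    (suspended-size i) (basis-size t′ i)
    where
    suspended-size : ∀ i k → ∣ suspended (basis t) i k ∣ ≡ i
    suspended-size (suc i) k = cong suc (basis-size t i k)

  -- For a set lifted from the contraction, the pivot form itself lies outside the set and serves
  -- every h off the hyperplane. A nonzero h on the hyperplane is `embed` of a nonzero vector, for
  -- which the contraction provides a form.
  basis-avoids : ∀ {t} {A : Forms d n} → Eliminates t A → ∀ i k {h} → Nonzero h → Avoids A (basis t i k) h
  basis-avoids point zero k h≉0 = ⊥-elim (h≉0 λ ())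
  basis-avoids (loop A₀≈0 elim) i k h≉0 with basis-avoids elim i k h≉0
  ... | j , j∉S , Aj#0 = suc j , j∉S , Aj#0
  basis-avoids {t = pivot t t′} {A} (pivot {j = j} Aj#0 elim elim′) i k {h} h≉0 =
    ++-all {P = λ S → Avoids A S h} (suspended (basis t) i) _ (avoids i) avoids′ k
    where
    open Hyperplane (A zero) j Aj#0
    avoids : ∀ i k → Avoids A (suspended (basis t) i k) h
    avoids (suc i) k with basis-avoids elim i k h≉0
    ... | j , j∉S , Ajh#0 = suc j , j∉S , Ajh#0
    avoids′ : ∀ k → Avoids A (outside ∷ basis t′ i k) h
    avoids′ k with ≈0⊎#0 ⟨ A zero , h ⟩
    ... | inj₂ Ah#0 = zero , ≡refl , Ah#0
    ... | inj₁ Ah≈0 with basis-avoids elim′ i k {removeAt h j} x≉0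
      where
      x≉0 : Nonzero (removeAt h j)
      x≉0 x≈0 = h≉0 λ i → trans (embed-removeAt {h} Ah≈0 i) (embed-zero {removeAt h j} x≈0 i)
    ...   | i′ , i∉S , Bix#0 = suc i′ , i∉S , #-congʳ (trans (sym (embed-pullback (A (suc i′)) (removeAt h j)))
              (⟨⟩-congʳ (A (suc i′)) {embed (removeAt h j)} {h} λ k → sym (embed-removeAt {h} Ah≈0 k))) Bix#0

  -- Independence and spanning of the basis products

  comb : Vector Carrier m → Vector (Functional d) m → Functional d
  comb a F w = sum λ k → a k * F k w

  comb-zero : ∀ (a : Vector Carrier m) (F : Vector (Functional d) m) {w} → (∀ k → F k w ≈ 0#) → comb a F w ≈ 0#
  comb-zero a F F≈0 = sum-zero λ k → *-zeroʳ′ (a k) (F≈0 k)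

  comb-isForm : ∀ (a : Vector Carrier m) {F : Vector (Functional d) m} → (∀ k → IsForm (F k)) → IsForm (comb a F)
  comb-isForm {m = zero}  a F-form = zero-isForm
  comb-isForm {m = suc m} a F-form = axpy-isForm (a zero) (F-form zero) (comb-isForm (a ∘ suc) (F-form ∘ suc))

  mul-comb : ∀ (l : Vector Carrier d) (a : Vector Carrier m) F → mul l (comb a F) ≋ comb a (mul l ∘ F)
  mul-comb {m = zero}  l a F w = mul-zero l w
  mul-comb {m = suc m} l a F w =
    trans (mul-linear l (a zero) (F zero) (comb (a ∘ suc) (F ∘ suc)) w) (+-congˡ (mul-comb l (a ∘ suc) (F ∘ suc) w))

  comb-++ : ∀ {k} (a : Vector Carrier (m ℕ.+ k)) (P : Subset n → Functional d) xs ys w →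
    comb a (P ∘ (xs Vector.++ ys)) w ≈ comb (a ∘ (_↑ˡ k)) (P ∘ xs) w + comb (a ∘ (m ↑ʳ_)) (P ∘ ys) w
  comb-++ {m = m} {k = k} a P xs ys w = trans (sum-++ m _) (+-cong
    (sum-cong-≋ λ i → *-congˡ (reflexive (cong (λ S → P S w) (Vectorₚ.lookup-++ˡ xs ys i))))
    (sum-cong-≋ λ i → *-congˡ (reflexive (cong (λ S → P S w) (Vectorₚ.lookup-++ʳ xs ys i)))))

  comb-join : ∀ {k} (a : Vector Carrier m) (b : Vector Carrier k) (P : Subset n → Functional d) xs ys w →
    comb (a Vector.++ b) (P ∘ (xs Vector.++ ys)) w ≈ comb a (P ∘ xs) w + comb b (P ∘ ys) w
  comb-join a b P xs ys w = trans (comb-++ (a Vector.++ b) P xs ys w) (+-cong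
    (sum-cong-≋ λ i → *-congʳ (reflexive (Vectorₚ.lookup-++ˡ a b i)))
    (sum-cong-≋ λ i → *-congʳ (reflexive (Vectorₚ.lookup-++ʳ a b i))))

  ++-elim : ∀ {p} {P : Fin (m ℕ.+ n) → Set p} → (∀ i → P (i ↑ˡ n)) → (∀ i → P (m ↑ʳ i)) → ∀ i → P i
  ++-elim {zero}  Pˡ Pʳ i       = Pʳ i
  ++-elim {suc m} Pˡ Pʳ zero    = Pˡ zero
  ++-elim {suc m} {P = P} Pˡ Pʳ (suc i) = ++-elim {P = P ∘ suc} (Pˡ ∘ suc) Pʳ i

  -- Restricted to the hyperplane, the products containing the pivot form vanish, so independence in
  -- the contraction kills the coefficients of the lifted products. What remains is the pivot form
  -- times a combination for the deletion, and multiplication is injective.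
  basis-independent : ∀ {t} {A : Forms d n} → Eliminates t A → ∀ i (a : Vector Carrier (hilb t i)) →
                      (∀ w → comb a (prod A ∘ basis t i) w ≈ 0#) → ∀ k → a k ≈ 0#
  basis-independent point zero a comb≈0 zero =
    trans (sym (trans (+-identityʳ _) (*-identityʳ (a zero)))) (comb≈0 [])
  basis-independent (loop _ elim) i a comb≈0 = basis-independent elim i a comb≈0
  basis-independent {t = pivot t t′} {A} (pivot {j = j} Aj#0 elim elim′) i a comb≈0 =
    ++-elim (suspended-independent i a₁ comb₁≈0) a₂≈0
    where
    open Hyperplane (A zero) j Aj#0
    a₁ = a ∘ (_↑ˡ hilb t′ i)
    a₂ = a ∘ (suspend (hilb t) i ↑ʳ_)
    suspended-zero : ∀ i k w → prod A (suspended (basis t) i k) (map embed w) ≈ 0#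
    suspended-zero (suc i) k = mul-map-zero embed embed-kernel (prod (A ∘ suc) (basis t i k))
    split : ∀ w → comb a₁ (prod A ∘ suspended (basis t) i) w + comb a₂ (prod (A ∘ suc) ∘ basis t′ i) w ≈ 0#
    split w = trans (sym (comb-++ a (prod A) (suspended (basis t) i) _ w)) (comb≈0 w)
    a₂≈0 : ∀ k → a₂ k ≈ 0#
    a₂≈0 = basis-independent elim′ i a₂ λ w → begin
      comb a₂ (prod (contraction A Aj#0) ∘ basis t′ i) w
        ≈⟨ sum-cong-≋ (λ k → *-congˡ (prod-map (A ∘ suc) (contraction A Aj#0) embed (embed-pullback ∘ A ∘ suc) (basis t′ i k) w)) ⟨
      comb a₂ (prod (A ∘ suc) ∘ basis t′ i) (map embed w)
        ≈⟨ trans (+-congʳ (comb-zero a₁ (prod A ∘ suspended (basis t) i) {map embed w} λ k → suspended-zero i k w)) (+-identityˡ _) ⟨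
      comb a₁ (prod A ∘ suspended (basis t) i) (map embed w) + comb a₂ (prod (A ∘ suc) ∘ basis t′ i) (map embed w)
        ≈⟨ split (map embed w) ⟩
      0# ∎
    comb₁≈0 : ∀ w → comb a₁ (prod A ∘ suspended (basis t) i) w ≈ 0#
    comb₁≈0 w = trans (sym (trans (+-congˡ (sum-zero λ k → *-zeroˡ′ _ (a₂≈0 k))) (+-identityʳ _))) (split w)
    suspended-independent : ∀ i a → (∀ w → comb a (prod A ∘ suspended (basis t) i) w ≈ 0#) → ∀ k → a k ≈ 0#
    suspended-independent (suc i) a comb≈0 = basis-independent elim i a
      (mul-injective (A zero) transversal (#-congʳ (sym ⟨⟩-transversal) 1#0) _
        λ w → trans (mul-comb (A zero) a (prod (A ∘ suc) ∘ basis t i) w) (comb≈0 w))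

  homogeneous-0 : ∀ {F : Functional d} → Homogeneous 0 F → F [] ≈ 0# → ∀ w → F w ≈ 0#
  homogeneous-0 F-hom F[]≈0 []      = F[]≈0
  homogeneous-0 F-hom F[]≈0 (h ∷ w) = F-hom (h ∷ w) λ ()

  basis-InC : ∀ {t} {A : Forms d n} → Eliminates t A → ∀ i k → InC A (prod A (basis t i k))
  basis-InC {t = t} {A} elim i k h h≉0 = prod-kills A (basis t i k) (basis-avoids elim i k h≉0)

  basis-homogeneous : ∀ (t : DCTree e n) (A : Forms d n) i k → Homogeneous i (prod A (basis t i k))
  basis-homogeneous t A i k = subst (λ j → Homogeneous j (prod A (basis t i k))) (basis-size t i k)
    (prod-homogeneous A (basis t i k))

  module _ {A : Forms (suc d) (suc n)} {j} (Aj#0 : A zero j # 0#) where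
    open Hyperplane (A zero) j Aj#0

    restriction-isForm : ∀ {F} → IsForm F → IsForm (F ∘ map embed)
    restriction-isForm F-form .perm v↭w = perm F-form (↭ₚ.map⁺ embed v↭w)
    restriction-isForm F-form .linear {a} {x} {y} {z} z≈ w =
      linear F-form {a} {embed x} {embed y} {embed z} (embed-linear {a} {x} {y} {z} z≈) (map embed w)

    restriction-homogeneous : ∀ {i F} → Homogeneous i F → Homogeneous i (F ∘ map embed)
    restriction-homogeneous F-hom w |w|≢ = F-hom (map embed w) (|w|≢ ∘ ≡trans (≡sym (Listₚ.length-map embed w)))

    restriction-InC : ∀ {F} → InC A F → InC (contraction A Aj#0) (F ∘ map embed)
    restriction-InC {F} F∈C x x≉0 w =
      trans (reflexive (cong F words)) (F∈C (embed x) (embed-nonzero {x} x≉0) (map embed w))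
      where
      B = contraction A Aj#0
      ρ≡ : ρ B x ≡ ρ A (embed x)
      ρ≡ = ≡sym (≡trans (ρ-miss A {embed x} (embed-kernel x))
        (ρ-cong (A ∘ suc) B {embed x} {x} λ i → embed-pullback (A (suc i)) x))
      words : map embed (replicate (ρ B x) x ++ w) ≡ replicate (ρ A (embed x)) (embed x) ++ map embed w
      words = ≡trans (Listₚ.map-++ embed (replicate (ρ B x) x) w) (cong (_++ map embed w)
        (≡trans (Listₚ.map-replicate embed (ρ B x) x) (cong (λ m → replicate m (embed x)) ρ≡)))

  Spans : (t : DCTree d n) → Forms d n → ℕ → Set (c Level.⊔ ℓ₁)
  Spans {d} t A i = ∀ {F : Functional d} → IsForm F → Homogeneous i F → InC A F →
                    ∃[ a ] F ≋ comb a (prod A ∘ basis t i)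

  module _ {t : DCTree (suc d) n} {t′ : DCTree d n} {A : Forms (suc d) (suc n)} {j} (Aj#0 : A zero j # 0#)
           (elim : Eliminates t (A ∘ suc)) (elim′ : Eliminates t′ (contraction A Aj#0)) where
    open Hyperplane (A zero) j Aj#0

    suspended-spans : ∀ i → (∀ i → Spans t (A ∘ suc) i) →
      ∀ {E} → IsForm E → Homogeneous i E → (∀ w → E (map embed w) ≈ 0#) → InC A E →
      ∃[ a ] E ≋ comb a (prod A ∘ suspended (basis t) i)
    suspended-spans zero    t-spans E-form E-hom E∣≈0 E∈C = (λ ()) , homogeneous-0 E-hom (E∣≈0 [])
    suspended-spans (suc i) t-spans {E} E-form E-hom E∣≈0 E∈C = quotient (divide {l = A zero} Aj#0 {i} {E} E-form E-hom E∣≈0)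
      where
      quotient : ∃[ G ] IsForm G × Homogeneous i G × E ≋ mul (A zero) G →
                 ∃[ a ] E ≋ comb a (prod A ∘ suspended (basis t) (suc i))
      quotient (G , G-form , G-hom , E≋lG) = combine (t-spans i G-form G-hom (InC-mul⁻ A {F = G} Aj#0 lG∈C))
        where
        lG∈C : InC A (mul (A zero) G)
        lG∈C h h≉0 w = trans (sym (E≋lG (replicate (ρ A h) h ++ w))) (E∈C h h≉0 w)
        combine : ∃[ a ] G ≋ comb a (prod (A ∘ suc) ∘ basis t i) →
                  ∃[ a ] E ≋ comb a (prod A ∘ suspended (basis t) (suc i))
        combine (a , G≋) = a , λ w →
          trans (E≋lG w) (trans (mul-cong (A zero) G≋ w) (mul-comb (A zero) a (prod (A ∘ suc) ∘ basis t i) w))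

    lift : ∀ i → Vector (Functional (suc d)) (hilb t′ i)
    lift i k = prod (A ∘ suc) (basis t′ i k)

    lift-restriction : ∀ i b w → comb b (lift i) (map embed w) ≈ comb b (prod (contraction A Aj#0) ∘ basis t′ i) w
    lift-restriction i b w = sum-cong-≋ λ k → *-congˡ
      (prod-map (A ∘ suc) (contraction A Aj#0) embed (λ i → embed-pullback (A (suc i))) (basis t′ i k) w)

    lift-InC : ∀ i k → InC A (lift i k)
    -- The lifted products form the second half of the basis for `pivot t t′`, whose members are
    -- already known to lie in C.
    lift-InC i k = subst (λ S → InC A (prod A S))
      (Vectorₚ.lookup-++ʳ (suspended (basis t) i) (λ k → outside ∷ basis t′ i k) k)
      (basis-InC {t = pivot t t′} (pivot Aj#0 elim elim′) i (suspend (hilb t) i ↑ʳ k))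

    remainder : ∀ i → Vector Carrier (hilb t′ i) → Functional (suc d) → Functional (suc d)
    remainder i b F w = - 1# * comb b (lift i) w + F w

    -- The restriction of F lies in C of the contraction and is a combination with some coefficients
    -- `b`. Subtracting the combination of lifts with the same `b` leaves a member of C that
    -- vanishes on the hyperplane, hence is divisible by the pivot form with quotient in C of the
    -- deletion.
    pivot-spans : ∀ i → (∀ i → Spans t (A ∘ suc) i) → Spans t′ (contraction A Aj#0) i → Spans (pivot t t′) A i
    pivot-spans i t-spans t′-spans {F} F-form F-hom F∈C = uncurry restricted (t′-spans {F ∘ map embed}
        (restriction-isForm {A = A} Aj#0 F-form) (restriction-homogeneous {A = A} Aj#0 F-hom) (restriction-InC {A = A} Aj#0 {F} F∈C))
      where
      restricted : ∀ b → F ∘ map embed ≋ comb b (prod (contraction A Aj#0) ∘ basis t′ i) →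
                   ∃[ a ] F ≋ comb a (prod A ∘ basis (pivot t t′) i)
      restricted b F∣≋ = join (suspended-spans i t-spans {E} E-form E-hom E∣≈0 E∈C)
        where
        E = remainder i b F
        E-form : IsForm E
        E-form = axpy-isForm (- 1#) (comb-isForm b λ k → prod-isForm (A ∘ suc) (basis t′ i k)) F-form
        E-hom : Homogeneous i E
        E-hom w |w|≢ = +-zero
          (*-zeroʳ′ _ (comb-zero b (lift i) {w} λ k → basis-homogeneous t′ (A ∘ suc) i k w |w|≢)) (F-hom w |w|≢)
        E∣≈0 : ∀ w → E (map embed w) ≈ 0#
        E∣≈0 w = trans (+-congˡ (trans (F∣≋ w) (sym (lift-restriction i b w)))) (-1*x+x≈0 (comb b (lift i) (map embed w)))
        E∈C : InC A E
        E∈C h h≉0 w = +-zero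
          (*-zeroʳ′ _ (comb-zero b (lift i) {replicate (ρ A h) h ++ w} λ k → lift-InC i k h h≉0 w)) (F∈C h h≉0 w)
        join : ∃[ a ] E ≋ comb a (prod A ∘ suspended (basis t) i) → ∃[ a ] F ≋ comb a (prod A ∘ basis (pivot t t′) i)
        join (a , E≋) = a Vector.++ b , λ w → begin
          F w
            ≈⟨ +-identityˡ (F w) ⟨
          0# + F w
            ≈⟨ +-congʳ (-1*x+x≈0 (comb b (lift i) w)) ⟨
          (- 1# * comb b (lift i) w + comb b (lift i) w) + F w
            ≈⟨ solve 3 (λ m p f → (m :+ p) :+ f := (m :+ f) :+ p) refl (- 1# * comb b (lift i) w) (comb b (lift i) w) (F w) ⟩
          E w + comb b (lift i) w
            ≈⟨ +-congʳ (E≋ w) ⟩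
          comb a (prod A ∘ suspended (basis t) i) w + comb b (lift i) w
            ≈⟨ comb-join a b (prod A) (suspended (basis t) i) (λ k → outside ∷ basis t′ i k) w ⟨
          comb (a Vector.++ b) (prod A ∘ basis (pivot t t′) i) w ∎

  basis-spans : ∀ {t} {A : Forms d n} → Eliminates t A → ∀ i → Spans t A i
  basis-spans point zero {F} F-form F-hom F∈C = const (F []) , λ
    { []      → sym (trans (+-identityʳ _) (*-identityʳ _))
    ; (h ∷ w) → trans (F-hom (h ∷ w) λ ()) (sym (+-zero (zeroʳ _) refl)) }
  -- In dimension 0 each letter is the zero vector, so multilinearity makes F vanish on nonempty
  -- words.
  basis-spans point (suc i) {F} F-form F-hom F∈C = (λ ()) , λ
    { []      → F-hom [] λ ()
    ; (h ∷ w) → headZero F-form (λ ()) w }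
  -- With no forms, ρ is 0 at the nonzero vector `const 1#`, so membership in C says that F itself
  -- is zero.
  basis-spans (flat {d}) i F-form F-hom F∈C =
    (λ ()) , F∈C (const 1#) (#0⇒nonzero {h = const 1#} {j = zero} 1#0)
  basis-spans {A = A} (loop A₀≈0 elim) i {F} F-form F-hom F∈C = basis-spans elim i F-form F-hom λ h h≉0 →
    subst (λ m → Kills h m F) (ρ-miss A {h} (⟨⟩-zeroˡ A₀≈0 h)) (F∈C h h≉0)
  basis-spans (pivot Aj#0 elim elim′) i =
    pivot-spans Aj#0 elim elim′ i (basis-spans elim) (basis-spans elim′ i)

  -- Polynomials and their iterated derivatives at 0

  Coefficients : ℕ → Set c
  Coefficients d = Vec ℕ d → Carrier

  -- Here `c α` is the value at 0 of the partial derivative with multi-index `α`, not a coefficient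
  -- of a monomial, so no multiplicity appears. The factor α_j + 1 in `∂` is absorbed by the ratio
  -- of factorials.
  D : Vector Carrier d → Coefficients d → Coefficients d
  D h c α = ⟨ h , (λ j → c (updateAt α j suc)) ⟩

  D-cong : ∀ (h : Vector Carrier d) {c c′} → (∀ α → c α ≈ c′ α) → ∀ α → D h c α ≈ D h c′ α
  D-cong h c≈c′ α = ⟨⟩-congʳ h λ j → c≈c′ (updateAt α j suc)

  D-comm : ∀ (x y : Vector Carrier d) c α → D x (D y c) α ≈ D y (D x c) α
  D-comm x y c α = begin
    sum (λ j → x j * sum (λ i → y i * c (updateAt (updateAt α j suc) i suc)))
      ≈⟨ sum-cong-≋ (λ j → *-distribˡ-sum (x j) λ i → y i * c (updateAt (updateAt α j suc) i suc)) ⟩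
    sum (λ j → sum λ i → x j * (y i * c (updateAt (updateAt α j suc) i suc)))
      ≈⟨ ∑-comm (λ j i → x j * (y i * c (updateAt (updateAt α j suc) i suc))) ⟩
    sum (λ i → sum λ j → x j * (y i * c (updateAt (updateAt α j suc) i suc)))
      ≈⟨ sum-cong-≋ (λ i → sum-cong-≋ λ j → trans (exchange (x j) (y i) (c (updateAt (updateAt α j suc) i suc)))
           (*-congˡ (*-congˡ (reflexive (cong c (commutes i j)))))) ⟩
    sum (λ i → sum λ j → y i * (x j * c (updateAt (updateAt α i suc) j suc)))
      ≈⟨ sum-cong-≋ (λ i → *-distribˡ-sum (y i) λ j → x j * c (updateAt (updateAt α i suc) j suc)) ⟨
    sum (λ i → y i * sum (λ j → x j * c (updateAt (updateAt α i suc) j suc))) ∎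
    where
    exchange : ∀ a b z → a * (b * z) ≈ b * (a * z)
    exchange = solve 3 (λ a b z → a :* (b :* z) := b :* (a :* z)) refl
    commutes : ∀ i j → updateAt (updateAt α j suc) i suc ≡ updateAt (updateAt α i suc) j suc
    commutes i j with i ≟ j
    ... | yes ≡refl = ≡refl
    ... | no i≢j    = Vecₚ.updateAt-commutes i j i≢j α

  taylor : Coefficients d → Functional d
  taylor c []      = c (Vec.replicate _ 0)
  taylor c (h ∷ w) = taylor (D h c) w

  taylor-cong : ∀ {c c′ : Coefficients d} → (∀ α → c α ≈ c′ α) → taylor c ≋ taylor c′
  taylor-cong c≈c′ []      = c≈c′ _
  taylor-cong c≈c′ (h ∷ w) = taylor-cong (D-cong h c≈c′) w

  taylor-zero : ∀ {c : Coefficients d} → (∀ α → c α ≈ 0#) → ∀ w → taylor c w ≈ 0#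
  taylor-zero c≈0 []      = c≈0 _
  taylor-zero c≈0 (h ∷ w) = taylor-zero (λ α → ⟨⟩-zeroʳ h λ j → c≈0 (updateAt α j suc)) w

  taylor-linear : ∀ a (c c′ : Coefficients d) → taylor (λ α → a * c α + c′ α) ≋ λ w → a * taylor c w + taylor c′ w
  taylor-linear a c c′ []      = refl
  taylor-linear a c c′ (h ∷ w) =
    trans (taylor-cong (λ α → ⟨⟩-linear h λ j → refl) w) (taylor-linear a (D h c) (D h c′) w)

  taylor-isForm : ∀ (c : Coefficients d) → IsForm (taylor c)
  taylor-isForm c .perm v↭w = go c v↭w
    where
    go : ∀ c {v w : Word _} → v ↭ w → taylor c v ≈ taylor c w
    go c ↭refl = refl
    go c (prep h p) = go (D h c) p
    go c {_ ∷ _ ∷ v} (swap x y p) = trans (taylor-cong (D-comm y x c) v) (go (D x (D y c)) p)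
    go c (↭trans p q) = trans (go c p) (go c q)
  taylor-isForm c .linear {a} {x} {y} {z} z≈ w = trans (taylor-cong D-linear w) (taylor-linear a (D x c) (D y c) w)
    where
    D-linear : ∀ α → D z c α ≈ a * D x c α + D y c α
    D-linear α = begin
      ⟨ z , ∂c ⟩                   ≈⟨ ⟨⟩-comm z ∂c ⟩
      ⟨ ∂c , z ⟩                   ≈⟨ ⟨⟩-linear ∂c {a} {x} {y} z≈ ⟩
      a * ⟨ ∂c , x ⟩ + ⟨ ∂c , y ⟩  ≈⟨ +-cong (*-congˡ (⟨⟩-comm ∂c x)) (⟨⟩-comm ∂c y) ⟩
      a * ⟨ x , ∂c ⟩ + ⟨ y , ∂c ⟩  ∎
      where
      ∂c : Vector Carrier _
      ∂c j = c (updateAt α j suc)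

  fold-shift : ∀ {a} {A : Set a} (z : A) s m → fold (s z) s m ≡ s (fold z s m)
  fold-shift z s zero    = ≡refl
  fold-shift z s (suc m) = cong s (fold-shift z s m)

  taylor-replicate : ∀ (h : Vector Carrier d) m c w → taylor c (replicate m h ++ w) ≈ taylor (fold c (D h) m) w
  taylor-replicate h zero    c w = refl
  taylor-replicate h (suc m) c w = trans (taylor-replicate h m (D h c) w)
    (reflexive (cong (λ c → taylor c w) (fold-shift c (D h) m)))

  letters : Vec ℕ d → List (Fin d)
  letters []      = []
  letters (a ∷ α) = replicate a zero ++ map suc (letters α)

  letters-zero : ∀ d → letters (Vec.replicate d 0) ≡ []
  letters-zero zero    = ≡refl
  letters-zero (suc d) = cong (map suc) (letters-zero d)

  letters-updateAt : ∀ (α : Vec ℕ d) j → letters (updateAt α j suc) ↭ j ∷ letters α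
  letters-updateAt (a ∷ α) zero    = ↭refl
  letters-updateAt (a ∷ α) (suc j) = ↭trans
    (↭ₚ.++⁺ˡ (replicate a zero) (↭ₚ.map⁺ suc (letters-updateAt α j)))
    (↭ₚ.shift (suc j) (replicate a zero) (map suc (letters α)))

  length-letters : ∀ (α : Vec ℕ d) → length (letters α) ≡ Vec.sum α
  length-letters []      = ≡refl
  length-letters (a ∷ α) = ≡trans (Listₚ.length-++ (replicate a zero)) (cong₂ ℕ._+_ (Listₚ.length-replicate a)
    (≡trans (Listₚ.length-map suc (letters α)) (length-letters α)))

  sum-updateAt : ∀ (α : Vec ℕ d) j → Vec.sum (updateAt α j suc) ≡ suc (Vec.sum α)
  sum-updateAt α j = ≡trans (≡sym (length-letters (updateAt α j suc)))
    (≡trans (↭ₚ.↭-length (letters-updateAt α j)) (cong suc (length-letters α)))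

  exponents : List (Fin d) → Vec ℕ d
  exponents []       = Vec.replicate _ 0
  exponents (j ∷ js) = updateAt (exponents js) j suc

  exponents-letters : ∀ (α : Vec ℕ d) → exponents (letters α) ≡ α
  exponents-letters []      = ≡refl
  exponents-letters (a ∷ α) = ≡trans (zeros a) (cong (a ∷_) (exponents-letters α))
    where
    sucs : ∀ js → exponents (map suc js) ≡ 0 ∷ exponents js
    sucs []       = ≡refl
    sucs (j ∷ js) = cong (λ β → updateAt β (suc j) suc) (sucs js)
    zeros : ∀ a → exponents (replicate a zero ++ map suc (letters α)) ≡ a ∷ exponents (letters α)
    zeros zero    = sucs (letters α)
    zeros (suc a) = cong (λ β → updateAt β zero suc) (zeros a)

  basisWord : Vec ℕ d → Word d
  basisWord α = map basisVector (letters α)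

  length-basisWord : ∀ (α : Vec ℕ d) → length (basisWord α) ≡ Vec.sum α
  length-basisWord α = ≡trans (Listₚ.length-map basisVector (letters α)) (length-letters α)

  taylor-basisWord : ∀ (c : Coefficients d) α → taylor c (basisWord α) ≈ c α
  taylor-basisWord c α = trans (go c (letters α)) (reflexive (cong c (exponents-letters α)))
    where
    next : Coefficients _ → List (Fin _) → Vector Carrier _
    next c js j = c (updateAt (exponents js) j suc)
    go : ∀ c js → taylor c (map basisVector js) ≈ c (exponents js)
    go c []       = refl
    go c (j ∷ js) = trans (go (D (basisVector j) c) js) (trans (⟨⟩-comm (basisVector j) (next c js)) (⟨⟩-basisVector (next c js) j))

  form-sum : ∀ {F : Functional d} → IsForm F → ∀ (a : Vector Carrier m) (v : Vector (Vector Carrier d) m) z →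
             (∀ i → z i ≈ sum λ k → a k * v k i) →
             ∀ w → F (z ∷ w) ≈ sum λ k → a k * F (v k ∷ w)
  form-sum {m = zero}  F-form a v z z≈ w = headZero F-form z≈ w
  form-sum {m = suc m} F-form a v z z≈ w = trans (linear F-form z≈ w)
    (+-congˡ (form-sum F-form (a ∘ suc) (v ∘ suc) (λ i → sum λ k → a (suc k) * v (suc k) i) (λ _ → refl) w))

  form-basis : ∀ {F : Functional d} → IsForm F → ∀ h w → F (h ∷ w) ≈ sum λ j → h j * F (basisVector j ∷ w)
  form-basis F-form h = form-sum F-form h basisVector h λ i → sym (trans
    (sum-single (λ j → h j * basisVector j i) i λ j j≢i → *-zeroʳ′ (h j) (basisVector-off (j≢i ∘ ≡sym)))
    (trans (*-congˡ (basisVector-diag i)) (*-identityʳ (h i))))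

  -- A symmetric multilinear function is determined by its values on words of basis vectors, and by
  -- symmetry on one ordering per multi-index, namely `basisWord α`.
  taylor-form : ∀ {F : Functional d} → IsForm F → taylor (F ∘ basisWord) ≋ F
  taylor-form {d} {F} F-form []      = reflexive (cong (F ∘ map basisVector) (letters-zero d))
  taylor-form {d} {F} F-form (h ∷ w) = trans (taylor-cong D-form w) (taylor-form (derivative-isForm F-form h) w)
    where
    D-form : ∀ α → D h (F ∘ basisWord) α ≈ F (h ∷ basisWord α)
    D-form α = trans (sum-cong-≋ λ j → *-congˡ (perm F-form (↭ₚ.map⁺ basisVector (letters-updateAt α j))))
                     (sym (form-basis F-form h (basisWord α)))

  taylor-homogeneous : ∀ {c : Coefficients d} {i} → (∀ α → Vec.sum α ≢ i → c α ≈ 0#) → Homogeneous i (taylor c)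
  taylor-homogeneous {d} {c} {i} c-hom w |w|≢ = go 0 c
    (λ α |α|≢ → c-hom α (|α|≢ ∘ ≡trans (ℕₚ.+-identityʳ _))) w (|w|≢ ∘ ≡trans (≡sym (ℕₚ.+-identityʳ _)))
    where
    -- `s` counts the derivatives already taken, so that `c` is homogeneous of degree i - s without
    -- a subtraction.
    go : ∀ s (c : Coefficients d) → (∀ α → Vec.sum α ℕ.+ s ≢ i → c α ≈ 0#) → ∀ w → length w ℕ.+ s ≢ i → taylor c w ≈ 0#
    go s c c-hom []      s≢i  = c-hom _ λ eq → s≢i (≡trans (cong (ℕ._+ s)
      (≡trans (cong length (≡sym (letters-zero d))) (length-letters (Vec.replicate d 0)))) eq)
    go s c c-hom (h ∷ w) |w|≢ = go (suc s) (D h c)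
      (λ α |α|≢ → ⟨⟩-zeroʳ h λ j → c-hom (updateAt α j suc) λ eq → |α|≢
        (≡trans (ℕₚ.+-suc (Vec.sum α) s) (≡trans (cong (ℕ._+ s) (≡sym (sum-updateAt α j))) eq)))
      w (|w|≢ ∘ ≡trans (≡sym (ℕₚ.+-suc (length w) s)))

  -- Translation between polynomials and functionals

  fact : ℕ → Carrier
  fact zero    = 1#
  fact (suc a) = (suc a ×ᴷ 1#) * fact a

  factorial : Vec ℕ d → Carrier
  factorial []      = 1#
  factorial (a ∷ α) = fact a * factorial α

  factorial#0 : ∀ (α : Vec ℕ d) → factorial α # 0#
  factorial#0 []      = 1#0
  factorial#0 (a ∷ α) = x#0y#0→xy#0 (fact#0 a) (factorial#0 α)
    where
    fact#0 : ∀ a → fact a # 0#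
    fact#0 zero    = 1#0
    fact#0 (suc a) = x#0y#0→xy#0 (suc×1#0 a) (fact#0 a)

  factorial-updateAt : ∀ (α : Vec ℕ d) j → factorial (updateAt α j suc) ≈ (suc (lookup α j) ×ᴷ 1#) * factorial α
  factorial-updateAt (a ∷ α) zero    = *-assoc _ _ _
  factorial-updateAt (a ∷ α) (suc j) = trans (*-congˡ (factorial-updateAt α j))
    (solve 3 (λ f n g → f :* (n :* g) := n :* (f :* g)) refl (fact a) (suc (lookup α j) ×ᴷ 1#) (factorial α))

  -- The values at 0 of the partial derivatives of f.
  derivatives : Poly d → Coefficients d
  derivatives f α = factorial α * coeff f α

  coeff-linearCombination : ∀ (a : Vector Carrier m) (b : Vector (Poly d) m) α →
    coeff (linearCombination rawK (polySpace d) a b) α ≡ sum λ k → a k * coeff (b k) α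
  coeff-linearCombination {zero}  a b α = ≡refl
  coeff-linearCombination {suc m} a b α = cong (a zero * coeff (b zero) α +_) (coeff-linearCombination (a ∘ suc) (b ∘ suc) α)

  derivatives-D : ∀ (h : Vector Carrier d) f α → derivatives (directionalDerivative h f) α ≈ D h (derivatives f) α
  derivatives-D h f α = begin
    factorial α * coeff (directionalDerivative h f) α
      ≈⟨ *-congˡ (reflexive (coeff-linearCombination h (λ j → ∂ j f) α)) ⟩
    factorial α * sum (λ j → h j * coeff (∂ j f) α)
      ≈⟨ *-distribˡ-sum (factorial α) (λ j → h j * coeff (∂ j f) α) ⟩
    sum (λ j → factorial α * (h j * coeff (∂ j f) α))
      ≈⟨ sum-cong-≋ term ⟩
    sum (λ j → h j * derivatives f (updateAt α j suc)) ∎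
    where
    term : ∀ j → factorial α * (h j * coeff (∂ j f) α) ≈ h j * derivatives f (updateAt α j suc)
    term j = begin
      factorial α * (h j * coeff (∂ j f) α)
        ≈⟨ *-congˡ (*-congˡ (×ᴷ≈* (suc (lookup α j)) _)) ⟩
      factorial α * (h j * ((suc (lookup α j) ×ᴷ 1#) * coeff f (updateAt α j suc)))
        ≈⟨ solve 4 (λ p h n x → p :* (h :* (n :* x)) := h :* (n :* p :* x)) refl
             (factorial α) (h j) (suc (lookup α j) ×ᴷ 1#) (coeff f (updateAt α j suc)) ⟩
      h j * ((suc (lookup α j) ×ᴷ 1#) * factorial α * coeff f (updateAt α j suc))
        ≈⟨ *-congˡ (*-congʳ (factorial-updateAt α j)) ⟨
      h j * derivatives f (updateAt α j suc) ∎

  derivatives-fold : ∀ (h : Vector Carrier d) f m α →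
    derivatives (fold f (directionalDerivative h) m) α ≈ fold (derivatives f) (D h) m α
  derivatives-fold h f zero    α = refl
  derivatives-fold h f (suc m) α = trans (derivatives-D h (fold f (directionalDerivative h) m) α) (D-cong h (derivatives-fold h f m) α)

  C⇒InC : ∀ (l : Forms d n) {f} → C l f → InC l (taylor (derivatives f))
  C⇒InC l {f} f∈C h h≉0 w = trans (taylor-replicate h (ρ l h) (derivatives f) w) (taylor-zero (λ α →
    trans (sym (derivatives-fold h f (ρ l h) α)) (*-zeroʳ′ _ (f∈C h h≉0 α))) w)

  InC⇒C : ∀ (l : Forms d n) {f} → InC l (taylor (derivatives f)) → C l f
  InC⇒C l {f} F∈C h h≉0 α = *-cancelˡ-0 (factorial#0 α) (begin
    derivatives (fold f (directionalDerivative h) k) α   ≈⟨ derivatives-fold h f k α ⟩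
    fold (derivatives f) (D h) k α                       ≈⟨ taylor-basisWord (fold (derivatives f) (D h) k) α ⟨
    taylor (fold (derivatives f) (D h) k) (basisWord α)  ≈⟨ taylor-replicate h k (derivatives f) (basisWord α) ⟨
    taylor (derivatives f) (replicate k h ++ basisWord α) ≈⟨ F∈C h h≉0 (basisWord α) ⟩
    0#                                                   ∎)
    where k = ρ l h

  1/factorial : Vec ℕ d → Carrier
  1/factorial α = proj₁ (reciprocal (factorial#0 α))

  1/factorial-inverse : ∀ (α : Vec ℕ d) x → 1/factorial α * (factorial α * x) ≈ x
  1/factorial-inverse α x = trans (sym (*-assoc _ _ x)) (trans (*-congʳ (proj₂ (reciprocal (factorial#0 α)))) (*-identityˡ x))

  -- Taylor's formula at 0; homogeneity supplies the degree bound that an arbitrary functional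
  -- lacks.
  polynomial : ∀ {i} {F : Functional d} → Homogeneous i F → Poly d
  polynomial {F = F} F-hom .coeff α = 1/factorial α * F (basisWord α)
  polynomial {i = i} F-hom .bounded = i , λ α i<α →
    *-zeroʳ′ _ (F-hom (basisWord α) (ℕₚ.<⇒≢ i<α ∘ ≡sym ∘ ≡trans (≡sym (length-basisWord α))))

  polynomial-homogeneous : ∀ {i} {F : Functional d} (F-hom : Homogeneous i F) → IsHomogeneous i (polynomial F-hom)
  polynomial-homogeneous F-hom α α≢i = *-zeroʳ′ _ (F-hom (basisWord α) (α≢i ∘ ≡trans (≡sym (length-basisWord α))))

  taylor-polynomial : ∀ {i} {F : Functional d} → IsForm F → (F-hom : Homogeneous i F) →
                      taylor (derivatives (polynomial F-hom)) ≋ F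
  taylor-polynomial F-form F-hom w = trans (taylor-cong (λ α →
    trans (solve 3 (λ x y z → x :* (y :* z) := y :* (x :* z)) refl (factorial α) (1/factorial α) _) (1/factorial-inverse α _)) w)
    (taylor-form F-form w)

  -- Functionals are compared on the words `basisWord α`, where they give the partial derivatives at
  -- 0. Division by factorials then turns relations among products into relations among
  -- coefficients, and multiplication turns them back.
  hilb-isHilbertFunction : ∀ {t} (l : Forms d n) → Eliminates t l → IsHilbertFunction l (hilb t)
  hilb-isHilbertFunction {d} {t = t} l elim i = b , b∈C , independent , spanning
    where
    F : Vector (Functional d) (hilb t i)
    F k = prod l (basis t i k)
    F-hom : ∀ k → Homogeneous i (F k)
    F-hom = basis-homogeneous t l i
    F-form : ∀ k → IsForm (F k)
    F-form k = prod-isForm l (basis t i k)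
    b : Vector (Poly d) (hilb t i)
    b k = polynomial (F-hom k)
    b∈C : ∀ k → gradedC l i (b k)
    b∈C k = polynomial-homogeneous (F-hom k) , InC⇒C l {b k} λ h h≉0 w →
      trans (taylor-polynomial (F-form k) (F-hom k) _) (basis-InC elim i k h h≉0 w)
    coeff-b : ∀ a α → coeff (linearCombination rawK (polySpace d) a b) α ≈ 1/factorial α * comb a F (basisWord α)
    coeff-b a α = begin
      coeff (linearCombination rawK (polySpace d) a b) α
        ≈⟨ reflexive (coeff-linearCombination a b α) ⟩
      sum (λ k → a k * (1/factorial α * F k (basisWord α)))
        ≈⟨ sum-cong-≋ (λ k → solve 3 (λ a x f → a :* (x :* f) := x :* (a :* f)) refl (a k) (1/factorial α) (F k (basisWord α))) ⟩
      sum (λ k → 1/factorial α * (a k * F k (basisWord α)))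
        ≈⟨ *-distribˡ-sum (1/factorial α) (λ k → a k * F k (basisWord α)) ⟨
      1/factorial α * comb a F (basisWord α) ∎
    independent : LinearlyIndependent rawK (polySpace d) b
    independent a ab≈0 = basis-independent elim i a λ w →
      trans (sym (taylor-form (comb-isForm a F-form) w)) (taylor-zero (λ α → begin
        comb a F (basisWord α)                                  ≈⟨ 1/factorial-inverse α _ ⟨
        1/factorial α * (factorial α * comb a F (basisWord α))  ≈⟨ solve 3 (λ x y z → x :* (y :* z) := y :* (x :* z)) refl _ _ _ ⟩
        factorial α * (1/factorial α * comb a F (basisWord α))  ≈⟨ *-zeroʳ′ _ (trans (sym (coeff-b a α)) (ab≈0 α)) ⟩
        0#                                                      ∎) w)
    spanning : ∀ f → gradedC l i f → Span rawK (polySpace d) b ⊤ f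
    spanning f (f-hom , f∈C) with basis-spans elim i (taylor-isForm (derivatives f))
      (taylor-homogeneous λ α α≢i → *-zeroʳ′ _ (f-hom α α≢i)) (C⇒InC l {f} f∈C)
    ... | a , f≋ = a , (λ k∉⊤ → ⊥-elim (k∉⊤ ∈⊤)) , λ α → begin
      coeff f α                                              ≈⟨ 1/factorial-inverse α (coeff f α) ⟨
      1/factorial α * derivatives f α                        ≈⟨ *-congˡ (trans (sym (taylor-basisWord (derivatives f) α)) (f≋ (basisWord α))) ⟩
      1/factorial α * comb a F (basisWord α)                 ≈⟨ coeff-b a α ⟨
      coeff (linearCombination rawK (polySpace d) a b) α     ∎

  -- Ranks

  -- Gaussian elimination: a nonzero equation removes one unknown, by the same contraction as in the
  -- main recursion. The comparisons of dimensions below rest on this.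
  kernel : ∀ (A : Forms d m) → m < d → ∃[ h ] Nonzero h × (∀ i → ⟨ A i , h ⟩ ≈ 0#)
  kernel {suc d} {zero}  A _ = const 1# , #0⇒nonzero {h = const 1#} {j = zero} 1#0 , λ ()
  kernel {d}     {suc m} A m<d with nonzero? (A zero)
  kernel {d}     {suc m} A m<d | inj₁ A₀≈0 with kernel (A ∘ suc) (ℕₚ.<-trans (ℕₚ.n<1+n m) m<d)
  ... | h , h≉0 , Ah≈0 = h , h≉0 , λ { zero → ⟨⟩-zeroˡ A₀≈0 h ; (suc i) → Ah≈0 i }
  kernel {suc d} {suc m} A m<d | inj₂ (j , Aj#0) with kernel (contraction A Aj#0) (ℕ.s<s⁻¹ m<d)
  ... | x , x≉0 , Bx≈0 = embed x , embed-nonzero {x} x≉0 ,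
        λ { zero → embed-kernel x ; (suc i) → trans (embed-pullback (A (suc i)) x) (Bx≈0 i) }
    where open Hyperplane (A zero) j Aj#0

  _⊥_ : Vector Carrier d → Forms d n × Subset n → Set ℓ₁
  h ⊥ (A , S) = ∀ {i} → i ∈ S → ⟨ A i , h ⟩ ≈ 0#

  spans-true : ∀ {t} {A : Forms d n} → Eliminates t A → ∀ S → spans t S ≡ true → ∀ {h} → h ⊥ (A , S) → h ≈ⱽ 0ⱽ
  spans-true point S  eq h⊥S ()
  spans-true flat  [] ()
  spans-true (loop _ elim)        (x ∷ S)       eq h⊥S = spans-true elim S eq (h⊥S ∘ there)
  spans-true (pivot _ elim elim′) (outside ∷ S) eq h⊥S = spans-true elim S eq (h⊥S ∘ there)
  spans-true {A = A} (pivot {j = j} Aj#0 elim elim′) (inside ∷ S) eq {h} h⊥S i =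
    trans (embed-removeAt {h} (h⊥S here) i) (embed-zero {removeAt h j} (spans-true elim′ S eq {removeAt h j} λ {i} i∈S →
      trans (sym (embed-pullback (A (suc i)) (removeAt h j)))
        (trans (⟨⟩-congʳ (A (suc i)) {embed (removeAt h j)} {h} (λ k → sym (embed-removeAt {h} (h⊥S here) k))) (h⊥S (there i∈S)))) i)
    where open Hyperplane (A zero) j Aj#0

  spans-false : ∀ {t} {A : Forms d n} → Eliminates t A → ∀ S → spans t S ≡ false → ∃[ h ] Nonzero h × h ⊥ (A , S)
  spans-false flat [] eq = const 1# , #0⇒nonzero {h = const 1#} {j = zero} 1#0 , λ ()
  spans-false (loop A₀≈0 elim) (x ∷ S) eq with spans-false elim S eq
  ... | h , h≉0 , h⊥S = h , h≉0 , λ { here → ⟨⟩-zeroˡ A₀≈0 h ; (there i∈S) → h⊥S i∈S }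
  spans-false (pivot _ elim elim′) (outside ∷ S) eq with spans-false elim S eq
  ... | h , h≉0 , h⊥S = h , h≉0 , λ { (there i∈S) → h⊥S i∈S }
  spans-false {A = A} (pivot {j = j} Aj#0 elim elim′) (inside ∷ S) eq with spans-false elim′ S eq
  ... | x , x≉0 , x⊥S = embed x , embed-nonzero {x} x≉0 ,
        λ { here → embed-kernel x ; {suc i} (there i∈S) → trans (embed-pullback (A (suc i)) x) (x⊥S i∈S) }
    where open Hyperplane (A zero) j Aj#0

  linearCombination-coordinate : ∀ (a : Vector Carrier m) (v : Vector (Vector Carrier d) m) j →
    linearCombination rawK (coordinateSpace d) a v j ≡ sum λ k → a k * v k j
  linearCombination-coordinate {zero}  a v j = ≡refl
  linearCombination-coordinate {suc m} a v j =
    cong (a zero * v zero j +_) (linearCombination-coordinate (a ∘ suc) (v ∘ suc) j)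

  ⟨⟩-linearCombination : ∀ (a : Vector Carrier m) (v : Vector (Vector Carrier d) m) h →
    ⟨ linearCombination rawK (coordinateSpace d) a v , h ⟩ ≈ sum λ k → a k * ⟨ v k , h ⟩
  ⟨⟩-linearCombination {zero}  a v h = ⟨⟩-zeroˡ (λ _ → refl) h
  ⟨⟩-linearCombination {suc m} {d} a v h = begin
    ⟨ (λ j → a zero * v zero j + rest j) , h ⟩     ≈⟨ ⟨⟩-comm (λ j → a zero * v zero j + rest j) h ⟩
    ⟨ h , (λ j → a zero * v zero j + rest j) ⟩     ≈⟨ ⟨⟩-linear h {a zero} {v zero} {rest} (λ _ → refl) ⟩
    a zero * ⟨ h , v zero ⟩ + ⟨ h , rest ⟩         ≈⟨ +-cong (*-congˡ (⟨⟩-comm h (v zero))) (⟨⟩-comm h rest) ⟩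
    a zero * ⟨ v zero , h ⟩ + ⟨ rest , h ⟩         ≈⟨ +-congˡ (⟨⟩-linearCombination (a ∘ suc) (v ∘ suc) h) ⟩
    sum (λ k → a k * ⟨ v k , h ⟩)                  ∎
    where rest = linearCombination rawK (coordinateSpace d) (a ∘ suc) (v ∘ suc)

  independent⇒≤ : ∀ (b : Vector (Vector Carrier d) m) → LinearlyIndependent rawK (coordinateSpace d) b → m ≤ d
  independent⇒≤ {d} {m} b independent = ℕₚ.≮⇒≥ λ d<m → impossible (kernel (λ j k → b k j) d<m)
    where
    impossible : ¬ (∃[ a ] Nonzero a × (∀ j → ⟨ (λ k → b k j) , a ⟩ ≈ 0#))
    impossible (a , a≉0 , ba≈0) = a≉0 (independent a λ j →
      trans (reflexive (linearCombination-coordinate a b j)) (trans (⟨⟩-comm a (λ k → b k j)) (ba≈0 j)))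

  -- All `b k` are orthogonal to h. Choosing j with h_j invertible, a combination of them whose
  -- other coordinates vanish also has zero j-th coordinate. A linear relation therefore has to
  -- satisfy one equation fewer than the dimension.
  independent⇒< : ∀ (b : Vector (Vector Carrier d) m) → LinearlyIndependent rawK (coordinateSpace d) b →
                  ∀ {h} → Nonzero h → (∀ k → ⟨ b k , h ⟩ ≈ 0#) → m < d
  independent⇒< {zero}      b independent h≉0 bh≈0 = ⊥-elim (h≉0 λ ())
  independent⇒< {suc d} {m} b independent {h} h≉0 bh≈0 with nonzero-coordinate h≉0
  ... | j , hj#0 = ℕₚ.≰⇒> λ d<m → impossible (kernel (λ i k → b k (punchIn j i)) d<m)
    where
    impossible : ¬ (∃[ a ] Nonzero a × (∀ i → ⟨ (λ k → b k (punchIn j i)) , a ⟩ ≈ 0#))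
    impossible (a , a≉0 , ba≈0) = a≉0 (independent a (coordinatewise j vj≈0 off))
      where
      v = linearCombination rawK (coordinateSpace (suc d)) a b
      off : ∀ i → v (punchIn j i) ≈ 0#
      off i = trans (reflexive (linearCombination-coordinate a b (punchIn j i))) (trans (⟨⟩-comm a (λ k → b k (punchIn j i))) (ba≈0 i))
      vj≈0 : v j ≈ 0#
      vj≈0 = *-cancelˡ-0 hj#0 (begin
        h j * v j                                        ≈⟨ *-comm _ _ ⟩
        v j * h j                                        ≈⟨ +-identityʳ _ ⟨
        v j * h j + 0#                                   ≈⟨ +-congˡ (sum-zero λ i → *-zeroˡ′ _ (off i)) ⟨
        v j * h j + ⟨ removeAt v j , removeAt h j ⟩      ≈⟨ sum-remove (λ i → v i * h i) ⟨
        ⟨ v , h ⟩                                        ≈⟨ ⟨⟩-linearCombination a b h ⟩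
        sum (λ k → a k * ⟨ b k , h ⟩)                    ≈⟨ sum-zero (λ k → *-zeroʳ′ (a k) (bh≈0 k)) ⟩
        0#                                               ∎)

  span-⊥ : ∀ (l : Forms d n) S {h w} → h ⊥ (l , S) → Span rawK (coordinateSpace d) l S w → ⟨ w , h ⟩ ≈ 0#
  span-⊥ {d} l S {h} {w} h⊥S (a , a≈0 , w≈) = begin
    ⟨ w , h ⟩                                               ≈⟨ ⟨⟩-comm w h ⟩
    ⟨ h , w ⟩                                               ≈⟨ ⟨⟩-congʳ h w≈ ⟩
    ⟨ h , linearCombination rawK (coordinateSpace d) a l ⟩  ≈⟨ ⟨⟩-comm h (linearCombination rawK (coordinateSpace d) a l) ⟩
    ⟨ linearCombination rawK (coordinateSpace d) a l , h ⟩  ≈⟨ ⟨⟩-linearCombination a l h ⟩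
    sum (λ i → a i * ⟨ l i , h ⟩)                           ≈⟨ sum-zero term ⟩
    0#                                                      ∎
    where
    term : ∀ i → a i * ⟨ l i , h ⟩ ≈ 0#
    term i with i ∈? S
    ... | yes i∈S = *-zeroʳ′ (a i) (h⊥S i∈S)
    ... | no  i∉S = *-zeroˡ′ _ (a≈0 i∉S)

  ∈-span : ∀ (l : Forms d n) S {i} → i ∈ S → Span rawK (coordinateSpace d) l S (l i)
  ∈-span l S {i} i∈S = basisVector i , off , λ j → sym (begin
    linearCombination rawK (coordinateSpace _) (basisVector i) l j
      ≈⟨ reflexive (linearCombination-coordinate (basisVector i) l j) ⟩
    ⟨ basisVector i , (λ k → l k j) ⟩
      ≈⟨ ⟨⟩-comm (basisVector i) (λ k → l k j) ⟩
    ⟨ (λ k → l k j) , basisVector i ⟩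
      ≈⟨ ⟨⟩-basisVector (λ k → l k j) i ⟩
    l i j ∎)
    where
    off : ∀ {k} → k ∉ S → basisVector i k ≈ 0#
    off {k} k∉S = basisVector-off {i = k} {i} λ { ≡refl → k∉S i∈S }

  -- A basis with fewer than d members has a nonzero common zero h; since it spans the forms in `S`,
  -- they vanish at h too, against the hypothesis.
  spanning-rank : ∀ (l : Forms d n) S {s} → (∀ {h} → h ⊥ (l , S) → h ≈ⱽ 0ⱽ) →
    HasDimension rawK (coordinateSpace d) (Span rawK (coordinateSpace d) l S) s → s ≡ d
  spanning-rank {d} l S {s} spanning (b , b∈ , independent , b-spans) =
    ℕₚ.≤-antisym (independent⇒≤ b independent) (ℕₚ.≮⇒≥ λ s<d → impossible (kernel b s<d))
    where
    impossible : ¬ (∃[ h ] Nonzero h × (∀ k → ⟨ b k , h ⟩ ≈ 0#))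
    impossible (h , h≉0 , bh≈0) = h≉0 (spanning λ {i} i∈S →
      span-⊥ b ⊤ (λ {k} _ → bh≈0 k) (b-spans (l i) (∈-span l S i∈S)))

  nonspanning-rank : ∀ (l : Forms d n) S {s h} → Nonzero h → h ⊥ (l , S) →
    HasDimension rawK (coordinateSpace d) (Span rawK (coordinateSpace d) l S) s → s < d
  nonspanning-rank l S h≉0 h⊥S (b , b∈ , independent , _) =
    independent⇒< b independent h≉0 λ k → span-⊥ l S h⊥S (b∈ k)

  rank-spans : ∀ {t} {l : Forms d n} → Eliminates t l → ∀ {r} → IsRankFunction l r → ∀ S → HasRank d (spans t S) (r S)
  rank-spans {t = t} {l} elim isRank S with spans t S in eq
  ... | true  = spanning-rank l S (spans-true elim S eq) (isRank S)
  ... | false with spans-false elim S eq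
  ...   | h , h≉0 , h⊥S = nonspanning-rank l S h≉0 h⊥S (isRank S)

  essential⇒≤ : ∀ {l : Forms d n} → Essential l → d ≤ n
  essential⇒≤ {l = l} essential = ℕₚ.≮⇒≥ λ n<d → impossible (kernel l n<d)
    where
    impossible : ¬ (∃[ h ] Nonzero h × (∀ i → ⟨ l i , h ⟩ ≈ 0#))
    impossible (h , h≉0 , lh≈0) = h≉0 (essential h lh≈0)

  essential⇒rank : ∀ {l : Forms d n} → Essential l → ∀ {r} → IsRankFunction l r → r ⊤ ≡ d
  essential⇒rank {l = l} essential isRank =
    spanning-rank l ⊤ (λ {h} h⊥l → essential h λ i → h⊥l (∈⊤ {x = i})) (isRank ⊤)

-- Comparison of the two sides through one tree

open RawRing laurentRing using (_≈_; _*_; 1#)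

proposition4p14 : ∀ {c ℓ₁ ℓ₂} (K : HeytingField c ℓ₁ ℓ₂) (_#?_ : Decidable (HeytingField._#_ K)) →
    CharacteristicZero K →
    let open Arrangement K _#?_ in
    ∀ (d n : ℕ) (l : Forms d n) → Essential l →
    ∀ (r : Subset n → ℕ) → IsRankFunction l r →
    ∃[ a ] IsHilbertFunction l a
    × generatingFunction a ≈ q ^ (n ∸ r ⊤) * tutte laurentRing r 1# q⁻¹
proposition4p14 K _#?_ char0 d n l essential r isRank = uncurry eliminated (eliminate l)
  where
  open Arrangement K _#?_
  open Arrangements K _#?_ char0
  eliminated : ∀ t → Eliminates t l →
    ∃[ a ] IsHilbertFunction l a × generatingFunction a ≈ q ^ (n ∸ r ⊤) * tutte laurentRing r 1# q⁻¹
  eliminated t elim = hilb t , hilb-isHilbertFunction l elim , LaurentSeries.tutte-hilb t r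
    (essential⇒≤ essential) (essential⇒rank essential isRank) (rank-spans elim isRank)
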